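{- Let $k\ge 2$ be an integer and let $x$ be a real number with $x\ge (10^8\log k)/2$. There exists a tournament $R$ with vertex set $[k]=\{1,\dots,k\}$ such that for all pairs of weight functions $f,g:[k]\to[0,1]$ with $f+g\le 1$ (pointwise) and $\sum_{i=1}^k (f(i)+g(i))=2x$, we have $$\sum_{ij\in E(R)} f(i)g(j)\le 0.51x^2.$$
   Context: A tournament with vertex set $[k]$ is an orientation of the edges of the complete graph on $[k]$; $ij\in E(R)$ means that the edge between $i$ and $j$ is directed from $i$ to $j$. Logarithms are to base $e$. -}

module Defs where

open import Data.Bool using (Bool; false; not; if_then_else_)
open import Data.Fin using (Fin)
open import Data.Integer as ℤ using (+_; +<+; +≤+)
import Data.Integer.Properties as ℤ
import Data.Integer.Solver as ℤ-Solver
open import Data.Nat as ℕ using (ℕ; zero; suc; z≤n; s≤s)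
open import Data.Nat.Coprimality as Coprime using (1-coprimeTo)
import Data.Nat.Properties as ℕ
open import Data.Product using (∃; _,_; proj₁; proj₂)
open import Data.Rational as ℚ using (ℚ; mkℚ; 0ℚ; 1ℚ; ½; ∣_∣; *≤*; *<*)
import Data.Rational.Properties as ℚ
import Data.Rational.Solver as ℚ-Solver
import Data.Rational.Unnormalised as ℚᵘ
import Data.Rational.Unnormalised.Properties as ℚᵘ
open import Data.Sum using (inj₁; inj₂)
open import Data.Vec.Functional using (foldr)
open import Relation.Binary.PropositionalEquality
  using (_≡_; _≢_; refl; sym; trans; cong; subst; subst₂; module ≡-Reasoning)

-- The standard library has no real numbers; they are represented here by
-- Cauchy sequences of rationals, with the operations taken termwise.

Cauchy : (ℕ → ℚ) → Set
Cauchy s = ∀ ε → 0ℚ ℚ.< ε →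
  ∃ λ N → ∀ m n → N ℕ.≤ m → N ℕ.≤ n → ∣ s m ℚ.- s n ∣ ℚ.< ε

record ℝ : Set where
  constructor real
  field
    seq    : ℕ → ℚ
    cauchy : Cauchy seq

open ℝ public

infix 4 _≤_ _≃_

-- The order of the real numbers represented (the limits): comparing the
-- sequences termwise, without ε, would give a strictly stronger relation.
_≤_ : ℝ → ℝ → Set
x ≤ y = ∀ ε → 0ℚ ℚ.< ε →
  ∃ λ N → ∀ n → N ℕ.≤ n → seq x n ℚ.≤ seq y n ℚ.+ ε

-- Equality of the limits; _≡_ on ℝ would compare representatives.
_≃_ : ℝ → ℝ → Set
x ≃ y = ∀ ε → 0ℚ ℚ.< ε →
  ∃ λ N → ∀ n → N ℕ.≤ n → ∣ seq x n ℚ.- seq y n ∣ ℚ.≤ ε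

private
  0<1 : 0ℚ ℚ.< 1ℚ
  0<1 = *<* (+<+ (s≤s z≤n))

  0≤1 : 0ℚ ℚ.≤ 1ℚ
  0≤1 = ℚ.<⇒≤ 0<1

  half-pos : ∀ {ε} → 0ℚ ℚ.< ε → 0ℚ ℚ.< ε ℚ.* ½
  half-pos 0<ε = ℚ.*-monoˡ-<-pos ½ 0<ε

  halves : ∀ ε → ε ℚ.* ½ ℚ.+ ε ℚ.* ½ ≡ ε
  halves ε = trans (sym (ℚ.*-distribˡ-+ ε ½ ½)) (ℚ.*-identityʳ ε)

fromℚ : ℚ → ℝ
fromℚ q = real (λ _ → q) λ ε 0<ε → 0 , λ _ _ _ _ →
  subst (ℚ._< ε) (cong ∣_∣ (sym (ℚ.+-inverseʳ q))) 0<ε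

fromℕ : ℕ → ℝ
fromℕ n = fromℚ (mkℚ (+ n) 0 (Coprime.sym (1-coprimeTo n)))

0ℝ 1ℝ : ℝ
0ℝ = fromℚ 0ℚ
1ℝ = fromℚ 1ℚ

private
  +-cauchy : ∀ s t → Cauchy s → Cauchy t → Cauchy (λ n → s n ℚ.+ t n)
  +-cauchy s t cs ct ε 0<ε = M ℕ.⊔ N , λ m n le₁ le₂ → begin-strict
      ∣ (s m ℚ.+ t m) ℚ.- (s n ℚ.+ t n) ∣
        ≡⟨ cong ∣_∣ (lemma (s m) (t m) (s n) (t n)) ⟩
      ∣ (s m ℚ.- s n) ℚ.+ (t m ℚ.- t n) ∣
        ≤⟨ ℚ.∣p+q∣≤∣p∣+∣q∣ (s m ℚ.- s n) (t m ℚ.- t n) ⟩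
      ∣ s m ℚ.- s n ∣ ℚ.+ ∣ t m ℚ.- t n ∣
        <⟨ ℚ.+-mono-< (hs m n (ℕ.m⊔n≤o⇒m≤o M N le₁) (ℕ.m⊔n≤o⇒m≤o M N le₂))
                      (ht m n (ℕ.m⊔n≤o⇒n≤o M N le₁) (ℕ.m⊔n≤o⇒n≤o M N le₂)) ⟩
      ε ℚ.* ½ ℚ.+ ε ℚ.* ½
        ≡⟨ halves ε ⟩
      ε ∎
    where
    open ℚ.≤-Reasoning
    open ℚ-Solver.+-*-Solver
    M = proj₁ (cs (ε ℚ.* ½) (half-pos 0<ε))
    N = proj₁ (ct (ε ℚ.* ½) (half-pos 0<ε))
    hs = proj₂ (cs (ε ℚ.* ½) (half-pos 0<ε))
    ht = proj₂ (ct (ε ℚ.* ½) (half-pos 0<ε))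
    lemma : ∀ a b c d → (a ℚ.+ b) ℚ.- (c ℚ.+ d) ≡ (a ℚ.- c) ℚ.+ (b ℚ.- d)
    lemma = solve 4 (λ a b c d →
      (a :+ b) :- (c :+ d) := (a :- c) :+ (b :- d)) refl

  eventually-bounded : ∀ s → Cauchy s →
    ∃ λ N → ∃ λ B → ∀ n → N ℕ.≤ n → ∣ s n ∣ ℚ.≤ ∣ B ∣
  eventually-bounded s cs = N , ∣ s N ∣ ℚ.+ 1ℚ , λ n N≤n → begin
      ∣ s n ∣
        ≡⟨ cong ∣_∣ (lemma (s n) (s N)) ⟩
      ∣ s N ℚ.+ (s n ℚ.- s N) ∣
        ≤⟨ ℚ.∣p+q∣≤∣p∣+∣q∣ (s N) (s n ℚ.- s N) ⟩
      ∣ s N ∣ ℚ.+ ∣ s n ℚ.- s N ∣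
        ≤⟨ ℚ.+-monoʳ-≤ ∣ s N ∣ (ℚ.<⇒≤ (hs n N N≤n ℕ.≤-refl)) ⟩
      ∣ s N ∣ ℚ.+ 1ℚ
        ≡⟨ sym (ℚ.0≤p⇒∣p∣≡p
             (ℚ.+-mono-≤ (ℚ.0≤∣p∣ (s N)) 0≤1)) ⟩
      ∣ ∣ s N ∣ ℚ.+ 1ℚ ∣ ∎
    where
    open ℚ.≤-Reasoning
    open ℚ-Solver.+-*-Solver
    N = proj₁ (cs 1ℚ 0<1)
    hs = proj₂ (cs 1ℚ 0<1)
    lemma : ∀ a b → a ≡ b ℚ.+ (a ℚ.- b)
    lemma = solve 2 (λ a b → a := b :+ (a :- b)) refl

  scale : ∀ B ε → 0ℚ ℚ.< ε → ∃ λ δ → ∃ λ (_ : 0ℚ ℚ.< δ) → ∣ B ∣ ℚ.* δ ℚ.≤ ε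
  scale B ε 0<ε = δ , 0<δ , (begin
      ∣ B ∣ ℚ.* δ
        ≤⟨ ℚ.*-monoʳ-≤-nonNeg δ {{ℚ.nonNegative (ℚ.<⇒≤ 0<δ)}} b≤c ⟩
      c ℚ.* (ε ℚ.* (ℚ.1/ c))
        ≡⟨ cong (c ℚ.*_) (ℚ.*-comm ε (ℚ.1/ c)) ⟩
      c ℚ.* ((ℚ.1/ c) ℚ.* ε)
        ≡⟨ sym (ℚ.*-assoc c (ℚ.1/ c) ε) ⟩
      (c ℚ.* (ℚ.1/ c)) ℚ.* ε
        ≡⟨ cong (ℚ._* ε) (ℚ.*-inverseʳ c) ⟩
      1ℚ ℚ.* ε
        ≡⟨ ℚ.*-identityˡ ε ⟩
      ε ∎)
    where
    open ℚ.≤-Reasoning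
    c = ∣ B ∣ ℚ.+ 1ℚ
    b≤c : ∣ B ∣ ℚ.≤ c
    b≤c = subst (ℚ._≤ c) (ℚ.+-identityʳ ∣ B ∣)
            (ℚ.+-monoʳ-≤ ∣ B ∣ 0≤1)
    0<c : 0ℚ ℚ.< c
    0<c = ℚ.+-mono-≤-< (ℚ.0≤∣p∣ B) 0<1
    instance
      c-pos : ℚ.Positive c
      c-pos = ℚ.positive 0<c
      c-nonZero : ℚ.NonZero c
      c-nonZero = ℚ.pos⇒nonZero c
    δ = ε ℚ.* (ℚ.1/ c)
    0<δ : 0ℚ ℚ.< δ
    0<δ = subst (ℚ._< δ) (ℚ.*-zeroˡ (ℚ.1/ c))
            (ℚ.*-monoˡ-<-pos (ℚ.1/ c) {{ℚ.1/pos⇒pos c}} 0<ε)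

  -- |a b - c d| ≤ |a| |b - d| + |d| |a - c|
  *-cauchy : ∀ s t → Cauchy s → Cauchy t → Cauchy (λ n → s n ℚ.* t n)
  *-cauchy s t cs ct ε 0<ε =
    let η = ε ℚ.* ½ ℚ.* ½
        0<η = half-pos (half-pos 0<ε)
        S , A , s≤A = eventually-bounded s cs
        T , B , t≤B = eventually-bounded t ct
        δ₁ , 0<δ₁ , Aδ₁≤η = scale A η 0<η
        δ₂ , 0<δ₂ , Bδ₂≤η = scale B η 0<η
        N₁ , ht = ct δ₁ 0<δ₁
        N₂ , hs = cs δ₂ 0<δ₂
    in (S ℕ.⊔ T) ℕ.⊔ (N₁ ℕ.⊔ N₂) , λ m n le₁ le₂ →
      let
        S≤m = ℕ.m⊔n≤o⇒m≤o S T (ℕ.m⊔n≤o⇒m≤o (S ℕ.⊔ T) (N₁ ℕ.⊔ N₂) le₁)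
        T≤n = ℕ.m⊔n≤o⇒n≤o S T (ℕ.m⊔n≤o⇒m≤o (S ℕ.⊔ T) (N₁ ℕ.⊔ N₂) le₂)
        l₁  = ℕ.m⊔n≤o⇒n≤o (S ℕ.⊔ T) (N₁ ℕ.⊔ N₂) le₁
        l₂  = ℕ.m⊔n≤o⇒n≤o (S ℕ.⊔ T) (N₁ ℕ.⊔ N₂) le₂
        dt  = ht m n (ℕ.m⊔n≤o⇒m≤o N₁ N₂ l₁) (ℕ.m⊔n≤o⇒m≤o N₁ N₂ l₂)
        ds  = hs m n (ℕ.m⊔n≤o⇒n≤o N₁ N₂ l₁) (ℕ.m⊔n≤o⇒n≤o N₁ N₂ l₂)
      in begin-strict
      ∣ s m ℚ.* t m ℚ.- s n ℚ.* t n ∣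
        ≡⟨ cong ∣_∣ (lemma (s m) (t m) (s n) (t n)) ⟩
      ∣ s m ℚ.* (t m ℚ.- t n) ℚ.+ t n ℚ.* (s m ℚ.- s n) ∣
        ≤⟨ ℚ.∣p+q∣≤∣p∣+∣q∣ (s m ℚ.* (t m ℚ.- t n)) (t n ℚ.* (s m ℚ.- s n)) ⟩
      ∣ s m ℚ.* (t m ℚ.- t n) ∣ ℚ.+ ∣ t n ℚ.* (s m ℚ.- s n) ∣
        ≤⟨ ℚ.+-mono-≤
             (ℚ.≤-trans (prod (s m) (t m ℚ.- t n) A δ₁ (s≤A m S≤m) (ℚ.<⇒≤ dt)) Aδ₁≤η)
             (ℚ.≤-trans (prod (t n) (s m ℚ.- s n) B δ₂ (t≤B n T≤n) (ℚ.<⇒≤ ds)) Bδ₂≤η) ⟩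
      η ℚ.+ η
        ≡⟨ halves (ε ℚ.* ½) ⟩
      ε ℚ.* ½
        ≡⟨ sym (ℚ.+-identityʳ (ε ℚ.* ½)) ⟩
      ε ℚ.* ½ ℚ.+ 0ℚ
        <⟨ ℚ.+-monoʳ-< (ε ℚ.* ½) (half-pos 0<ε) ⟩
      ε ℚ.* ½ ℚ.+ ε ℚ.* ½
        ≡⟨ halves ε ⟩
      ε ∎
    where
    open ℚ.≤-Reasoning
    open ℚ-Solver.+-*-Solver
    lemma : ∀ a b c d → a ℚ.* b ℚ.- c ℚ.* d ≡ a ℚ.* (b ℚ.- d) ℚ.+ d ℚ.* (a ℚ.- c)
    lemma = solve 4 (λ a b c d →
      a :* b :- c :* d := a :* (b :- d) :+ d :* (a :- c)) refl
    prod : ∀ p q C δ → ∣ p ∣ ℚ.≤ ∣ C ∣ → ∣ q ∣ ℚ.≤ δ →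
           ∣ p ℚ.* q ∣ ℚ.≤ ∣ C ∣ ℚ.* δ
    prod p q C δ h₁ h₂ = begin
      ∣ p ℚ.* q ∣
        ≡⟨ ℚ.∣p*q∣≡∣p∣*∣q∣ p q ⟩
      ∣ p ∣ ℚ.* ∣ q ∣
        ≤⟨ ℚ.*-monoʳ-≤-nonNeg ∣ q ∣ {{ℚ.∣-∣-nonNeg q}} h₁ ⟩
      ∣ C ∣ ℚ.* ∣ q ∣
        ≤⟨ ℚ.*-monoˡ-≤-nonNeg ∣ C ∣ {{ℚ.∣-∣-nonNeg C}} h₂ ⟩
      ∣ C ∣ ℚ.* δ ∎

infixl 6 _+_
infixl 7 _*_

_+_ : ℝ → ℝ → ℝ
x + y = real (λ n → seq x n ℚ.+ seq y n) (+-cauchy (seq x) (seq y) (cauchy x) (cauchy y))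

_*_ : ℝ → ℝ → ℝ
x * y = real (λ n → seq x n ℚ.* seq y n) (*-cauchy (seq x) (seq y) (cauchy x) (cauchy y))

∑ : ∀ {n} → (Fin n → ℝ) → ℝ
∑ = foldr _+_ 0ℝ

1/suc : ℕ → ℚ
1/suc m = mkℚ (+ 1) m (1-coprimeTo (suc m))

-- harmonic a l = 1/(a+1) + 1/(a+2) + ⋯ + 1/(a+l)
harmonic : ℕ → ℕ → ℚ
harmonic a zero    = 0ℚ
harmonic a (suc l) = harmonic a l ℚ.+ 1/suc (a ℕ.+ l)

-- log k = ∫₁ᵏ dt/t.  With mesh 1/N, where N = n+1, the right-endpoint
-- Riemann sum over the (k-1)N subintervals of [1,k] is
--   ∑_{i=1}^{(k-1)N} (1/N) · 1/(1 + i/N) = ∑_{i=1}^{(k-1)N} 1/(N+i).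
-- (As k ∸ 1 truncates, log 0 has the junk value 0.)
logSeq : ℕ → ℕ → ℚ
logSeq k n = harmonic (suc n) ((k ℕ.∸ 1) ℕ.* suc n)

private
  harmonic-++ : ∀ a l l′ →
    harmonic a (l ℕ.+ l′) ≡ harmonic a l ℚ.+ harmonic (a ℕ.+ l) l′
  harmonic-++ a l zero rewrite ℕ.+-identityʳ l = sym (ℚ.+-identityʳ _)
  harmonic-++ a l (suc l′)
    rewrite ℕ.+-suc l l′ | harmonic-++ a l l′ | ℕ.+-assoc a l l′ =
    ℚ.+-assoc (harmonic a l) (harmonic (a ℕ.+ l) l′) _

  1/suc-anti : ∀ {m n} → m ℕ.≤ n → 1/suc n ℚ.≤ 1/suc m
  1/suc-anti m≤n = *≤* (+≤+ (ℕ.*-monoʳ-≤ 1 (s≤s m≤n)))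

  times : ℕ → ℚ → ℚ
  times zero    q = 0ℚ
  times (suc l) q = times l q ℚ.+ q

  harmonic-≤ : ∀ a l → harmonic (suc a) l ℚ.≤ times l (1/suc a)
  harmonic-≤ a zero    = ℚ.≤-refl
  harmonic-≤ a (suc l) = ℚ.+-mono-≤ (harmonic-≤ a l)
    (1/suc-anti (ℕ.≤-trans (ℕ.n≤1+n a) (ℕ.m≤m+n (suc a) l)))

  harmonic-≥ : ∀ a l b → a ℕ.+ l ℕ.≤ suc b → times l (1/suc b) ℚ.≤ harmonic a l
  harmonic-≥ a zero    b h = ℚ.≤-refl
  harmonic-≥ a (suc l) b h = ℚ.+-mono-≤
    (harmonic-≥ a l b (ℕ.≤-trans (ℕ.+-monoʳ-≤ a (ℕ.n≤1+n l)) h))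
    (1/suc-anti (ℕ.≤-pred (subst (ℕ._≤ suc b) (ℕ.+-suc a l) h)))

  toℚᵘ-times : ∀ l b → ℚ.toℚᵘ (times l (1/suc b)) ℚᵘ.≃ ℚᵘ.mkℚᵘ (+ l) b
  toℚᵘ-times zero    b = ℚᵘ.*≡* refl
  toℚᵘ-times (suc l) b = ℚᵘ.≃-trans
    (ℚ.toℚᵘ-homo-+ (times l (1/suc b)) (1/suc b))
    (ℚᵘ.≃-trans
      (ℚᵘ.+-congˡ (ℚ.toℚᵘ (1/suc b)) (toℚᵘ-times l b))
      (ℚᵘ.*≡* (lemma (+ l) (+ suc b))))
    where
    lemma : ∀ x y → (x ℤ.* y ℤ.+ + 1 ℤ.* y) ℤ.* y ≡ (+ 1 ℤ.+ x) ℤ.* (y ℤ.* y)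
    lemma = solve 2 (λ x y →
      (x :* y :+ con (+ 1) :* y) :* y := (con (+ 1) :+ x) :* (y :* y)) refl
      where open ℤ-Solver.+-*-Solver

  times-1/suc : ∀ l b c → l ℕ.* suc c ≡ suc b → times l (1/suc b) ≡ 1/suc c
  times-1/suc l b c eq = ℚ.toℚᵘ-injective (ℚᵘ.≃-trans (toℚᵘ-times l b)
    (ℚᵘ.*≡* (trans (sym (ℤ.pos-* l (suc c)))
      (cong +_ (trans eq (sym (ℕ.*-identityˡ (suc b))))))))

  -- With a = n+1 and k = j+1: dropping 1/(a+1) from 1/(a+1) + ⋯ + 1/(k(a+1))
  -- and 1/(ka+1) + ⋯ + 1/(ka+k) from the same sum gives logSeq k (n+1) and
  -- logSeq k n respectively.
  step : ∀ j n → 1/suc (suc n) ℚ.+ logSeq (suc j) (suc n) ≡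
                 logSeq (suc j) n ℚ.+ harmonic (suc j ℕ.* suc n) (suc j)
  step j n = begin
    1/suc a ℚ.+ harmonic (suc a) (j ℕ.* suc a)
      ≡⟨ cong (ℚ._+ harmonic (suc a) (j ℕ.* suc a)) first ⟨
    harmonic a 1 ℚ.+ harmonic (suc a) (j ℕ.* suc a)
      ≡⟨ cong (λ b → harmonic a 1 ℚ.+ harmonic b (j ℕ.* suc a)) (ℕ.+-comm a 1) ⟨
    harmonic a 1 ℚ.+ harmonic (a ℕ.+ 1) (j ℕ.* suc a)
      ≡⟨ harmonic-++ a 1 (j ℕ.* suc a) ⟨
    harmonic a (1 ℕ.+ j ℕ.* suc a)
      ≡⟨ cong (harmonic a) count ⟩
    harmonic a (j ℕ.* a ℕ.+ suc j)
      ≡⟨ harmonic-++ a (j ℕ.* a) (suc j) ⟩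
    harmonic a (j ℕ.* a) ℚ.+ harmonic (suc j ℕ.* a) (suc j) ∎
    where
    open ≡-Reasoning
    a = suc n
    first : harmonic a 1 ≡ 1/suc a
    first = trans (ℚ.+-identityˡ (1/suc (a ℕ.+ 0))) (cong 1/suc (ℕ.+-identityʳ a))
    count : 1 ℕ.+ j ℕ.* suc a ≡ j ℕ.* a ℕ.+ suc j
    count = trans (cong suc (trans (ℕ.*-suc j a) (ℕ.+-comm j (j ℕ.* a))))
                  (sym (ℕ.+-suc (j ℕ.* a) j))

  logSeq-step-≥ : ∀ j n → logSeq (suc j) n ℚ.≤ logSeq (suc j) (suc n)
  logSeq-step-≥ j n = cancel
    (1/suc (suc n)) (logSeq (suc j) n) (logSeq (suc j) (suc n)) (subst (1/suc (suc n) ℚ.+ logSeq (suc j) n ℚ.≤_)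
    (sym (step j n))
    (subst (ℚ._≤ logSeq (suc j) n ℚ.+ harmonic b (suc j))
      (ℚ.+-comm (logSeq (suc j) n) (1/suc (suc n)))
      (ℚ.+-monoʳ-≤ (logSeq (suc j) n)
        (subst (ℚ._≤ harmonic b (suc j))
          (times-1/suc (suc j) c (suc n) refl)
          (harmonic-≥ b (suc j) c (ℕ.≤-reflexive eq))))))
    where
    b = suc j ℕ.* suc n
    c = suc n ℕ.+ j ℕ.* suc (suc n)
    eq : b ℕ.+ suc j ≡ suc c
    eq = trans (ℕ.+-comm b (suc j)) (sym (ℕ.*-suc (suc j) (suc n)))
    cancel : ∀ p q r → p ℚ.+ q ℚ.≤ p ℚ.+ r → q ℚ.≤ r
    cancel p q r h = subst₂ ℚ._≤_ (lemma p q) (lemma p r)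
      (ℚ.+-monoʳ-≤ (ℚ.- p) h)
      where
      lemma : ∀ p q → ℚ.- p ℚ.+ (p ℚ.+ q) ≡ q
      lemma = solve 2 (λ p q → :- p :+ (p :+ q) := q) refl
        where open ℚ-Solver.+-*-Solver

  logSeq-step-≤ : ∀ j n → logSeq (suc j) (suc n) ℚ.+ 1/suc (suc n) ℚ.≤
                          logSeq (suc j) n ℚ.+ 1/suc n
  logSeq-step-≤ j n = subst (ℚ._≤ logSeq (suc j) n ℚ.+ 1/suc n)
    (trans (sym (step j n)) (ℚ.+-comm (1/suc (suc n)) (logSeq (suc j) (suc n))))
    (ℚ.+-monoʳ-≤ (logSeq (suc j) n)
      (subst (harmonic (suc j ℕ.* suc n) (suc j) ℚ.≤_)
        (times-1/suc (suc j) (n ℕ.+ j ℕ.* suc n) n refl)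
        (harmonic-≤ (n ℕ.+ j ℕ.* suc n) (suc j))))

  1/suc≥0 : ∀ n → 0ℚ ℚ.≤ 1/suc n
  1/suc≥0 n = *≤* (+≤+ z≤n)

  logSeq-mono : ∀ j n d → logSeq (suc j) n ℚ.≤ logSeq (suc j) (d ℕ.+ n)
  logSeq-mono j n zero    = ℚ.≤-refl
  logSeq-mono j n (suc d) = ℚ.≤-trans (logSeq-mono j n d) (logSeq-step-≥ j (d ℕ.+ n))

  logSeq+1/suc-anti : ∀ j n d →
    logSeq (suc j) (d ℕ.+ n) ℚ.+ 1/suc (d ℕ.+ n) ℚ.≤ logSeq (suc j) n ℚ.+ 1/suc n
  logSeq+1/suc-anti j n zero    = ℚ.≤-refl
  logSeq+1/suc-anti j n (suc d) =
    ℚ.≤-trans (logSeq-step-≤ j (d ℕ.+ n)) (logSeq+1/suc-anti j n d)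

  between : ∀ p q r → p ℚ.≤ q → q ℚ.≤ p ℚ.+ r → ∣ q ℚ.- p ∣ ℚ.≤ r
  between p q r p≤q q≤p+r = subst₂ ℚ._≤_
    (sym (ℚ.0≤p⇒∣p∣≡p (subst (ℚ._≤ q ℚ.- p) (ℚ.+-inverseʳ p)
      (ℚ.+-monoˡ-≤ (ℚ.- p) p≤q))))
    (lemma p r)
    (ℚ.+-monoˡ-≤ (ℚ.- p) q≤p+r)
    where
    lemma : ∀ p r → p ℚ.+ r ℚ.- p ≡ r
    lemma = solve 2 (λ p r → p :+ r :- p := r) refl
      where open ℚ-Solver.+-*-Solver

  logSeq-close : ∀ j m n → m ℕ.≤ n →
    ∣ logSeq (suc j) n ℚ.- logSeq (suc j) m ∣ ℚ.≤ 1/suc m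
  logSeq-close j m n m≤n = subst
    (λ n → ∣ logSeq (suc j) n ℚ.- logSeq (suc j) m ∣ ℚ.≤ 1/suc m)
    (ℕ.m∸n+n≡m m≤n)
    (between (logSeq (suc j) m) (logSeq (suc j) n′) (1/suc m)
      (logSeq-mono j m (n ℕ.∸ m))
      (ℚ.≤-trans
        (subst (ℚ._≤ logSeq (suc j) n′ ℚ.+ 1/suc n′)
          (ℚ.+-identityʳ (logSeq (suc j) n′))
          (ℚ.+-monoʳ-≤ (logSeq (suc j) n′) (1/suc≥0 n′)))
        (logSeq+1/suc-anti j m (n ℕ.∸ m))))
    where n′ = n ℕ.∸ m ℕ.+ m

  archimedean : ∀ ε → 0ℚ ℚ.< ε → ∃ λ N → 1/suc N ℚ.< ε
  archimedean (mkℚ (+ suc p) d _) _ = suc d , *<* (+<+ (begin-strict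
    1 ℕ.* suc d             ≡⟨ ℕ.*-identityˡ (suc d) ⟩
    suc d                   <⟨ ℕ.n<1+n (suc d) ⟩
    suc (suc d)             ≤⟨ ℕ.m≤m+n (suc (suc d)) (p ℕ.* suc (suc d)) ⟩
    suc p ℕ.* suc (suc d)   ∎))
    where open ℕ.≤-Reasoning
  archimedean (mkℚ (+ zero) d _)     (*<* (+<+ ()))
  archimedean (mkℚ ℤ.-[1+ _ ] d _)   (*<* ())

  logSeq-cauchy : ∀ k → Cauchy (logSeq k)
  logSeq-cauchy zero      = cauchy 0ℝ
  logSeq-cauchy (suc j) ε 0<ε with archimedean ε 0<ε
  ... | N , 1/N<ε = N , close
    where
    close : ∀ m n → N ℕ.≤ m → N ℕ.≤ n →
      ∣ logSeq (suc j) m ℚ.- logSeq (suc j) n ∣ ℚ.< ε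
    close m n N≤m N≤n with ℕ.≤-total n m
    ... | inj₁ n≤m = ℚ.≤-<-trans (logSeq-close j n m n≤m)
                       (ℚ.≤-<-trans (1/suc-anti N≤n) 1/N<ε)
    ... | inj₂ m≤n = subst (ℚ._< ε) (swap (logSeq (suc j) n) (logSeq (suc j) m))
                       (ℚ.≤-<-trans (logSeq-close j m n m≤n)
                         (ℚ.≤-<-trans (1/suc-anti N≤m) 1/N<ε))
      where
      swap : ∀ p q → ∣ p ℚ.- q ∣ ≡ ∣ q ℚ.- p ∣
      swap p q = trans (sym (ℚ.∣-p∣≡∣p∣ (p ℚ.- q)))
        (cong ∣_∣ (solve 2 (λ p q → :- (p :- q) := q :- p) refl p q))
        where open ℚ-Solver.+-*-Solver

log : ℕ → ℝ
log k = real (logSeq k) (logSeq-cauchy k)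

-- Vertices 1, …, k are represented by Fin k; i ⇒ j means ij ∈ E(R).
record Tournament (k : ℕ) : Set where
  infix 4 _⇒_
  field
    _⇒_      : Fin k → Fin k → Bool
    loopless : ∀ i → (i ⇒ i) ≡ false
    oriented : ∀ i j → i ≢ j → (j ⇒ i) ≡ not (i ⇒ j)

-- ∑E R h = ∑ h(i, j) over the pairs with ij ∈ E(R).
∑E : ∀ {k} → Tournament k → (Fin k → Fin k → ℝ) → ℝ
∑E R h = ∑ λ i → ∑ λ j → if i ⇒ j then h i j else 0ℝ
  where open Tournament R

module Submission where

-- Let m be a large multiple of log k.  Moving weight between two
-- fractional vertices towards the more profitable one never decreases a linear
-- form, so a weight function in [0,1] of total at most m can be replaced by the
-- indicator of a set of at most m vertices, first in f and then in g.  Scaling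
-- then gives ∑_{ij ∈ E(R)} f(i) g(j) ≤ 0.505 max(∑f, 2m) max(∑g, 2m) as soon as every
-- two sets A, B of at most m vertices span at most 0.505 m² arcs from A to B; this
-- is at most 0.505 x², because m is small compared with x.
--
-- The tournament comes from the method of conditional expectations.  For a random
-- tournament, 1.01^p 0.99^q has mean at most 1, where p and q count the pairs
-- (i, j) ∈ A × B with i ⇒ j and without.  There are at most (k+1)^(2m) pairs (A, B),
-- so some tournament has 1.01^p 0.99^q ≤ (k+1)^(2m) for all of them, and p > 0.505 m²
-- would make the left side exponential in m².

open import Algebra.Bundles using (CommutativeRing)
import Algebra.Properties.CommutativeMonoid.Sum as CommutativeMonoidSum
import Algebra.Properties.Semiring.Sum as SemiringSum
open import Data.Bool using (Bool; true; false; not; _∧_; if_then_else_)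
open import Data.Bool.Properties using (not-involutive)
open import Data.Fin using (Fin; zero; suc)
open import Data.Fin.Subset using (Subset; inside; outside)
open import Data.Integer as ℤ using (+_; +≤+; +<+)
import Data.Integer.Properties as ℤ
open import Data.List as List using (List; []; _∷_; _++_)
open import Data.List.Membership.Propositional using (_∈_)
open import Data.List.Membership.Propositional.Properties
  using (∈-map⁺; ∈-++⁺ˡ; ∈-++⁺ʳ; ∈-cartesianProduct⁺)
import Data.List.Properties as List
open import Data.List.Relation.Unary.Any using (here; there)
open import Data.Nat as ℕ using (ℕ; zero; suc; z≤n; s≤s)
open import Data.Nat.Coprimality as Coprime using (1-coprimeTo)
open import Data.Nat.ListAction using (sum)
import Data.Nat.Properties as ℕ
import Data.Nat.Solver as ℕ-Solver
open import Data.Product using (∃; Σ-syntax; _×_; _,_; proj₁; proj₂)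
open import Data.Rational as ℚ using (ℚ; mkℚ; 0ℚ; 1ℚ; ½; *≤*; *<*)
import Data.Rational.Properties as ℚ
import Data.Rational.Solver as ℚ-Solver
import Data.Rational.Unnormalised as ℚᵘ
import Data.Rational.Unnormalised.Properties as ℚᵘ
open import Data.Sum using (inj₁; inj₂)
open import Data.Vec using ([]; _∷_; head; tail; lookup)
open import Function using (_∘_)
open import Relation.Binary.PropositionalEquality
  using (_≡_; _≢_; refl; sym; trans; cong; cong₂; subst; subst₂)
open import Relation.Nullary using (contradiction; yes; no)
open import Relation.Nullary.Decidable using (toWitness)

open import Defs using (Tournament; harmonic; 1/suc; logSeq)

open SemiringSum ℕ.+-*-semiring using ()
  renaming (sum to ∑ℕ; sum-cong-≗ to ∑ℕ-cong; ∑-distrib-+ to ∑ℕ-+;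
            *-distribˡ-sum to *-∑ℕ)
open CommutativeMonoidSum ℕ.*-1-commutativeMonoid using ()
  renaming (sum to ∏; sum-cong-≗ to ∏-cong; ∑-distrib-+ to ∏-*)
open SemiringSum (CommutativeRing.semiring ℚ.+-*-commutativeRing) using ()
  renaming (sum to ∑ℚ; sum-cong-≗ to ∑ℚ-cong; ∑-distrib-+ to ∑ℚ-+;
            *-distribˡ-sum to *-∑ℚ; ∑-comm to ∑ℚ-comm)

-- The method of conditional expectations

module Conditional {X : Set} (ts : List X) where
  open import Data.Nat using (_+_; _*_; _^_; _≤_)
  open ℕ.≤-Reasoning

  total : (X → ℕ) → ℕ
  total w = sum (List.map w ts)

  total-cong : ∀ {w w′} → (∀ t → w t ≡ w′ t) → total w ≡ total w′
  total-cong eq = cong sum (List.map-cong eq ts)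

  total-bound : ∀ {w w′} c → (∀ t → w t ≤ w′ t * c) → total w ≤ total w′ * c
  total-bound {w} {w′} c h = go ts
    where
    go : ∀ us → sum (List.map w us) ≤ sum (List.map w′ us) * c
    go []       = z≤n
    go (t ∷ us) = ℕ.≤-trans (ℕ.+-mono-≤ (h t) (go us))
      (ℕ.≤-reflexive (sym (ℕ.*-distribʳ-+ c (w′ t) _)))

  total-+ : ∀ w w′ → total (λ t → w t + w′ t) ≡ total w + total w′
  total-+ w w′ = go ts
    where
    open ℕ-Solver.+-*-Solver using (solve; _:=_; _:+_; _:*_; con)
    go : ∀ us → sum (List.map (λ t → w t + w′ t) us) ≡
                sum (List.map w us) + sum (List.map w′ us)
    go []       = refl
    go (t ∷ us) = trans (cong (_+_ (w t + w′ t)) (go us))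
      (solve 4 (λ a b c d → (a :+ b) :+ (c :+ d) := (a :+ c) :+ (b :+ d)) refl
        (w t) (w′ t) _ _)

  choose : ∀ c (φ : X → Bool → ℕ) w → (∀ t → φ t true + φ t false ≤ c + c) →
           ∃ λ b → total (λ t → w t * φ t b) ≤ total w * c
  choose c φ w h with ℕ.≤-total (total λ t → w t * φ t true) (total w * c)
  ... | inj₁ le = true , le
  ... | inj₂ ge = false , ℕ.+-cancelˡ-≤ (total w * c) _ _ (begin
    total w * c + total (λ t → w t * φ t false)
      ≤⟨ ℕ.+-monoˡ-≤ _ ge ⟩
    total (λ t → w t * φ t true) + total (λ t → w t * φ t false)
      ≡⟨ total-+ _ _ ⟨
    total (λ t → w t * φ t true + w t * φ t false)
      ≤⟨ total-bound (c + c) (λ t → ℕ.≤-trans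
           (ℕ.≤-reflexive (sym (ℕ.*-distribˡ-+ (w t) _ _)))
           (ℕ.*-monoʳ-≤ (w t) (h t))) ⟩
    total w * (c + c)
      ≡⟨ ℕ.*-distribˡ-+ (total w) c c ⟩
    total w * c + total w * c ∎)

  chooseAll : ∀ c n (φ : X → Fin n → Bool → ℕ) w →
              (∀ t i → φ t i true + φ t i false ≤ c + c) →
              ∃ λ (v : Fin n → Bool) → total (λ t → w t * ∏ (λ i → φ t i (v i))) ≤ total w * c ^ n
  chooseAll c zero    φ w h = (λ ()) , total-bound 1 (λ _ → ℕ.≤-refl)
  chooseAll c (suc n) φ w h =
    let b , p = choose c (λ t → φ t zero) w (λ t → h t zero)
        v , q = chooseAll c n (λ t i → φ t (suc i)) (λ t → w t * φ t zero b)
                  (λ t i → h t (suc i))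
    in (λ { zero → b ; (suc i) → v i }) , (begin
      total (λ t → w t * (φ t zero b * ∏ (λ i → φ t (suc i) (v i))))
        ≡⟨ total-cong (λ t → ℕ.*-assoc (w t) (φ t zero b) _) ⟨
      total (λ t → w t * φ t zero b * ∏ (λ i → φ t (suc i) (v i)))
        ≤⟨ q ⟩
      total (λ t → w t * φ t zero b) * c ^ n
        ≤⟨ ℕ.*-monoˡ-≤ (c ^ n) p ⟩
      total w * c * c ^ n
        ≡⟨ ℕ.*-assoc (total w) c (c ^ n) ⟩
      total w * c ^ suc n ∎)

≤total : ∀ {X : Set} (w : X → ℕ) {t ts} → t ∈ ts → w t ℕ.≤ Conditional.total ts w
≤total w (here refl) = ℕ.m≤m+n (w _) _
≤total w (there t∈)  = ℕ.≤-trans (≤total w t∈) (ℕ.m≤n+m _ (w _))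

empty : Tournament 0
empty = record { _⇒_ = λ () ; loopless = λ () ; oriented = λ () }

extend : ∀ {n} → Tournament n → (Fin n → Bool) → Tournament (suc n)
extend {n} R v = record { _⇒_ = arc ; loopless = irrefl ; oriented = antisym }
  where
  open Tournament R
  arc : Fin (suc n) → Fin (suc n) → Bool
  arc zero    zero    = false
  arc zero    (suc j) = v j
  arc (suc i) zero    = not (v i)
  arc (suc i) (suc j) = i ⇒ j
  irrefl : ∀ i → arc i i ≡ false
  irrefl zero    = refl
  irrefl (suc i) = loopless i
  antisym : ∀ i j → i ≢ j → arc j i ≡ not (arc i j)
  antisym zero    zero    i≢j = contradiction refl i≢j
  antisym zero    (suc j) i≢j = refl
  antisym (suc i) zero    i≢j = sym (not-involutive (v i))
  antisym (suc i) (suc j) i≢j = oriented i j (i≢j ∘ cong suc)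

⟦_⟧ : Bool → ℕ
⟦ b ⟧ = if b then 1 else 0

module Weighted (u d c : ℕ) (d≤c : d ℕ.≤ c) (u+d≤c+c : u ℕ.+ d ℕ.≤ c ℕ.+ c)
                (u*d≤c*c : u ℕ.* d ℕ.≤ c ℕ.* c) where
  open import Data.Nat using (_+_; _*_; _^_; _≤_)
  open ℕ.≤-Reasoning
  open ℕ-Solver.+-*-Solver using (solve; _:=_; _:+_; _:*_; con)

  -- The factors are scaled by c, to stay in ℕ.  The diagonal contributes pairs with
  -- entry α false, at most c each.
  entry : Bool → Bool → ℕ
  entry false _     = c
  entry true  true  = u
  entry true  false = d

  entry-false : ∀ α → entry α false ≤ c
  entry-false false = ℕ.≤-refl
  entry-false true  = d≤c

  pair : ∀ α β → entry α true * entry β false + entry α false * entry β true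
                 ≤ c * c + c * c
  pair false false = ℕ.≤-refl
  pair false true  = begin
    c * d + c * u    ≡⟨ solve 3 (λ c u d → c :* d :+ c :* u := c :* (u :+ d)) refl c u d ⟩
    c * (u + d)      ≤⟨ ℕ.*-monoʳ-≤ c u+d≤c+c ⟩
    c * (c + c)      ≡⟨ ℕ.*-distribˡ-+ c c c ⟩
    c * c + c * c    ∎
  pair true  false = begin
    u * c + d * c    ≡⟨ solve 3 (λ c u d → u :* c :+ d :* c := c :* (u :+ d)) refl c u d ⟩
    c * (u + d)      ≤⟨ ℕ.*-monoʳ-≤ c u+d≤c+c ⟩
    c * (c + c)      ≡⟨ ℕ.*-distribˡ-+ c c c ⟩
    c * c + c * c    ∎
  pair true  true  = ℕ.+-mono-≤ u*d≤c*c (ℕ.≤-trans (ℕ.≤-reflexive (ℕ.*-comm d u)) u*d≤c*c)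

  value : ∀ {n} → Tournament n → Subset n → Subset n → ℕ
  value R A B = ∏ λ i → ∏ λ j → entry (lookup A i ∧ lookup B j) (i ⇒ j)
    where open Tournament R

  module _ {n} (R : Tournament n) (v : Fin n → Bool) where
    open Tournament R

    value-extend : ∀ a b A B → value (extend R v) (a ∷ A) (b ∷ B) ≡
      entry (a ∧ b) false *
      ∏ (λ i → entry (a ∧ lookup B i) (v i) * entry (lookup A i ∧ b) (not (v i))) *
      value R A B
    value-extend a b A B = begin-equality
      E * ∏ row * ∏ (λ i → col i * rest i)
        ≡⟨ cong (E * ∏ row *_) (∏-* col rest) ⟩
      E * ∏ row * (∏ col * ∏ rest)
        ≡⟨ solve 4 (λ e r c v → e :* r :* (c :* v)
                := e :* (r :* c) :* v) refl E (∏ row) (∏ col) (∏ rest) ⟩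
      E * (∏ row * ∏ col) * ∏ rest
        ≡⟨ cong (λ z → E * z * ∏ rest) (∏-* row col) ⟨
      E * ∏ (λ i → row i * col i) * ∏ rest ∎
      where
      E = entry (a ∧ b) false
      row = λ i → entry (a ∧ lookup B i) (v i)
      col = λ i → entry (lookup A i ∧ b) (not (v i))
      rest = λ i → ∏ λ j → entry (lookup A i ∧ lookup B j) (i ⇒ j)

  module _ {X : Set} (ts : List X) where
    open Conditional ts

    tournament : ∀ n (A B : X → Subset n) w → ∃ λ R →
      total (λ t → w t * value R (A t) (B t)) ≤ total w * c ^ (n * n)
    tournament zero    A B w = empty , total-bound 1 (λ _ → ℕ.≤-refl)
    tournament (suc n) A B w = extend R v , (begin
        total (λ t → w t * value (extend R v) (A t) (B t))
          ≤⟨ total-bound {w′ = λ t → w t * ∏ (λ i → φ t i (v i)) * value R (A′ t) (B′ t)} c split ⟩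
        total (λ t → w t * ∏ (λ i → φ t i (v i)) * value R (A′ t) (B′ t)) * c
          ≤⟨ ℕ.*-monoˡ-≤ c (proj₂ rest) ⟩
        total (λ t → w t * ∏ (λ i → φ t i (v i))) * c ^ (n * n) * c
          ≤⟨ ℕ.*-monoˡ-≤ c (ℕ.*-monoˡ-≤ (c ^ (n * n)) (proj₂ first)) ⟩
        total w * (c * c) ^ n * c ^ (n * n) * c
          ≡⟨ cong (λ z → total w * z ^ n * c ^ (n * n) * c) (cong (c *_) (ℕ.*-identityʳ c)) ⟨
        total w * (c ^ 2) ^ n * c ^ (n * n) * c
          ≡⟨ cong (λ z → total w * z * c ^ (n * n) * c) (ℕ.^-*-assoc c 2 n) ⟩
        total w * c ^ (2 * n) * c ^ (n * n) * c
          ≡⟨ solve 4 (λ w x y c → w :* x :* y :* c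
                  := w :* (c :* (x :* y))) refl (total w) (c ^ (2 * n)) (c ^ (n * n)) c ⟩
        total w * (c * (c ^ (2 * n) * c ^ (n * n)))
          ≡⟨ cong (λ z → total w * (c * z)) (ℕ.^-distribˡ-+-* c (2 * n) (n * n)) ⟨
        total w * c ^ suc (2 * n + n * n)
          ≡⟨ cong (λ z → total w * c ^ z) (solve 1 (λ n → con 1 :+ (con 2 :* n :+ n :* n)
                  := (con 1 :+ n) :* (con 1 :+ n)) refl n) ⟩
        total w * c ^ (suc n * suc n) ∎)
      where
      a = λ t → head (A t)
      b = λ t → head (B t)
      A′ = λ t → tail (A t)
      B′ = λ t → tail (B t)
      φ : X → Fin n → Bool → ℕ
      φ t i r = entry (a t ∧ lookup (B′ t) i) r * entry (lookup (A′ t) i ∧ b t) (not r)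
      first = chooseAll (c * c) n φ w
        (λ t i → pair (a t ∧ lookup (B′ t) i) (lookup (A′ t) i ∧ b t))
      v = proj₁ first
      rest = tournament n A′ B′ (λ t → w t * ∏ (λ i → φ t i (v i)))
      R = proj₁ rest
      split : ∀ t → w t * value (extend R v) (A t) (B t) ≤
                    w t * ∏ (λ i → φ t i (v i)) * value R (A′ t) (B′ t) * c
      split t with A t | B t
      ... | a ∷ A | b ∷ B = begin
        w t * value (extend R v) (a ∷ A) (b ∷ B)
          ≡⟨ cong (w t *_) (value-extend R v a b A B) ⟩
        w t * (entry (a ∧ b) false * P * value R A B)
          ≤⟨ ℕ.*-monoʳ-≤ (w t) (ℕ.*-monoˡ-≤ (value R A B) (ℕ.*-monoˡ-≤ P (entry-false (a ∧ b)))) ⟩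
        w t * (c * P * value R A B)
          ≡⟨ solve 4 (λ w c p v → w :* (c :* p :* v) := w :* p :* v :* c) refl (w t) c P (value R A B) ⟩
        w t * P * value R A B * c ∎
        where P = ∏ (λ i → entry (a ∧ lookup B i) (v i) * entry (lookup A i ∧ b) (not (v i)))

-- Counting arcs between small sets

module _ where
  open import Data.Nat using (_+_; _*_; _^_; _≤_)
  open ℕ.≤-Reasoning
  open ℕ-Solver.+-*-Solver using (solve; _:=_; _:*_)

  ∏-powers : ∀ u d c {n} (p q z : Fin n → ℕ) →
    ∏ (λ i → u ^ p i * d ^ q i * c ^ z i) ≡ u ^ ∑ℕ p * d ^ ∑ℕ q * c ^ ∑ℕ z
  ∏-powers u d c {zero}  p q z = refl
  ∏-powers u d c {suc n} p q z = begin-equality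
    U * D * C * ∏ (λ i → u ^ p (suc i) * d ^ q (suc i) * c ^ z (suc i))
      ≡⟨ cong (U * D * C *_) (∏-powers u d c (p ∘ suc) (q ∘ suc) (z ∘ suc)) ⟩
    U * D * C * (u ^ P * d ^ Q * c ^ Z)
      ≡⟨ solve 6 (λ a b c x y z → a :* b :* c :* (x :* y :* z)
              := (a :* x) :* (b :* y) :* (c :* z)) refl U D C (u ^ P) (d ^ Q) (c ^ Z) ⟩
    (U * u ^ P) * (D * d ^ Q) * (C * c ^ Z)
      ≡⟨ cong₂ _*_ (cong₂ _*_ (ℕ.^-distribˡ-+-* u (p zero) P) (ℕ.^-distribˡ-+-* d (q zero) Q))
           (ℕ.^-distribˡ-+-* c (z zero) Z) ⟨
    u ^ ∑ℕ p * d ^ ∑ℕ q * c ^ ∑ℕ z ∎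
    where
    U = u ^ p zero
    D = d ^ q zero
    C = c ^ z zero
    P = ∑ℕ (p ∘ suc)
    Q = ∑ℕ (q ∘ suc)
    Z = ∑ℕ (z ∘ suc)

  ∑ℕ-const : ∀ n c → ∑ℕ {n} (λ _ → c) ≡ n * c
  ∑ℕ-const zero    c = refl
  ∑ℕ-const (suc n) c = cong (_+_ c) (∑ℕ-const n c)

  size : ∀ {n} → Subset n → ℕ
  size A = ∑ℕ λ i → ⟦ lookup A i ⟧

  count : ∀ {n} → (Bool → Bool → Bool) → Tournament n → Subset n → Subset n → ℕ
  count π R A B = ∑ℕ λ i → ∑ℕ λ j → ⟦ π (lookup A i ∧ lookup B j) (i ⇒ j) ⟧
    where open Tournament R

  arcs : ∀ {n} → Tournament n → Subset n → Subset n → ℕ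
  arcs = count _∧_

  coarcs : ∀ {n} → Tournament n → Subset n → Subset n → ℕ
  coarcs = count (λ α r → α ∧ not r)

  others : ∀ {n} → Tournament n → Subset n → Subset n → ℕ
  others = count (λ α _ → not α)

  count-+ : ∀ {n} π ρ σ → (∀ α r → ⟦ π α r ⟧ + ⟦ ρ α r ⟧ ≡ ⟦ σ α r ⟧) →
    ∀ (R : Tournament n) A B → count π R A B + count ρ R A B ≡ count σ R A B
  count-+ {n} π ρ σ h R A B = trans
    (sym (∑ℕ-+ {n} (λ i → ∑ℕ (cell π i)) (λ i → ∑ℕ (cell ρ i))))
    (∑ℕ-cong {n} λ i → trans (sym (∑ℕ-+ {n} (cell π i) (cell ρ i)))
                             (∑ℕ-cong {n} λ j → h (lookup A i ∧ lookup B j) (i ⇒ j)))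
    where
    open Tournament R
    cell : (Bool → Bool → Bool) → Fin n → Fin n → ℕ
    cell π i j = ⟦ π (lookup A i ∧ lookup B j) (i ⇒ j) ⟧

  count-∧ : ∀ {n} (R : Tournament n) A B → count (λ α _ → α) R A B ≡ size A * size B
  count-∧ {n} R A B = begin-equality
    ∑ℕ (λ i → ∑ℕ λ j → ⟦ lookup A i ∧ lookup B j ⟧)
      ≡⟨ ∑ℕ-cong {n} (λ i → trans (∑ℕ-cong {n} λ j → ∧-* (lookup A i) (lookup B j))
           (trans (sym (*-∑ℕ {n} ⟦ lookup A i ⟧ λ j → ⟦ lookup B j ⟧)) (ℕ.*-comm ⟦ lookup A i ⟧ _))) ⟩
    ∑ℕ (λ i → size B * ⟦ lookup A i ⟧)
      ≡⟨ *-∑ℕ {n} (size B) (λ i → ⟦ lookup A i ⟧) ⟨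
    size B * size A
      ≡⟨ ℕ.*-comm (size B) (size A) ⟩
    size A * size B ∎
    where
    ∧-* : ∀ a b → ⟦ a ∧ b ⟧ ≡ ⟦ a ⟧ * ⟦ b ⟧
    ∧-* false b = refl
    ∧-* true  b = sym (ℕ.*-identityˡ _)

  arcs+coarcs : ∀ {n} (R : Tournament n) A B → arcs R A B + coarcs R A B ≡ size A * size B
  arcs+coarcs R A B = trans
    (count-+ _∧_ (λ α r → α ∧ not r) (λ α _ → α)
      (λ { false _ → refl ; true true → refl ; true false → refl }) R A B)
    (count-∧ R A B)

  arcs+coarcs+others : ∀ {n} (R : Tournament n) A B → arcs R A B + coarcs R A B + others R A B ≡ n * n
  arcs+coarcs+others {n} R A B = begin-equality
    arcs R A B + coarcs R A B + others R A B
      ≡⟨ cong (_+ others R A B) (trans (arcs+coarcs R A B) (sym (count-∧ R A B))) ⟩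
    count (λ α _ → α) R A B + others R A B
      ≡⟨ count-+ (λ α _ → α) (λ α _ → not α) (λ _ _ → true)
           (λ { false _ → refl ; true _ → refl }) R A B ⟩
    ∑ℕ {n} (λ _ → ∑ℕ {n} (λ _ → 1))
      ≡⟨ ∑ℕ-const n _ ⟩
    n * ∑ℕ {n} (λ _ → 1)
      ≡⟨ cong (n *_) (trans (∑ℕ-const n 1) (ℕ.*-identityʳ n)) ⟩
    n * n ∎

  subsets : ∀ n → ℕ → List (Subset n)
  subsets zero    m       = [] ∷ []
  subsets (suc n) zero    = List.map (outside ∷_) (subsets n zero)
  subsets (suc n) (suc m) =
    List.map (outside ∷_) (subsets n (suc m)) ++ List.map (inside ∷_) (subsets n m)

  ∈-subsets : ∀ {n m} (A : Subset n) → size A ≤ m → A ∈ subsets n m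
  ∈-subsets {zero}              []            h       = here refl
  ∈-subsets {suc n} {m = zero}  (outside ∷ A) h       = ∈-map⁺ _ (∈-subsets A h)
  ∈-subsets {suc n} {m = suc m} (outside ∷ A) h       = ∈-++⁺ˡ (∈-map⁺ _ (∈-subsets A h))
  ∈-subsets {suc n} {m = suc m} (inside ∷ A)  (s≤s h) = ∈-++⁺ʳ _ (∈-map⁺ _ (∈-subsets A h))

  length-subsets : ∀ n m → List.length (subsets n m) ≤ suc n ^ m
  length-subsets zero    m       = ℕ.≤-reflexive (sym (ℕ.^-zeroˡ m))
  length-subsets (suc n) zero    = ℕ.≤-trans
    (ℕ.≤-reflexive (List.length-map _ (subsets n zero))) (length-subsets n zero)
  length-subsets (suc n) (suc m) = begin
    List.length (List.map (outside ∷_) (subsets n (suc m)) ++ List.map (inside ∷_) (subsets n m))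
      ≡⟨ trans (List.length-++ (List.map (outside ∷_) (subsets n (suc m))))
           (cong₂ _+_ (List.length-map _ (subsets n (suc m))) (List.length-map _ (subsets n m))) ⟩
    List.length (subsets n (suc m)) + List.length (subsets n m)
      ≤⟨ ℕ.+-mono-≤ (length-subsets n (suc m)) (length-subsets n m) ⟩
    suc n * suc n ^ m + suc n ^ m
      ≡⟨ ℕ.+-comm (suc n * suc n ^ m) (suc n ^ m) ⟩
    suc (suc n) * suc n ^ m
      ≤⟨ ℕ.*-monoʳ-≤ (suc (suc n)) (ℕ.^-monoˡ-≤ m (ℕ.n≤1+n (suc n))) ⟩
    suc (suc n) ^ suc m ∎

  length-cartesianProduct : ∀ {X Y : Set} (xs : List X) (ys : List Y) →
    List.length (List.cartesianProduct xs ys) ≡ List.length xs * List.length ys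
  length-cartesianProduct []       ys = refl
  length-cartesianProduct (x ∷ xs) ys = trans
    (List.length-++ (List.map (x ,_) ys))
    (cong₂ _+_ (List.length-map (x ,_) ys) (length-cartesianProduct xs ys))

  total-one : ∀ {X : Set} (ts : List X) → Conditional.total ts (λ _ → 1) ≡ List.length ts
  total-one []       = refl
  total-one (t ∷ ts) = cong suc (total-one ts)

  ^-*-distrib : ∀ x y n → (x * y) ^ n ≡ x ^ n * y ^ n
  ^-*-distrib x y zero    = refl
  ^-*-distrib x y (suc n) = trans (cong (x * y *_) (^-*-distrib x y n))
    (solve 4 (λ x y a b → x :* y :* (a :* b) := x :* a :* (y :* b)) refl x y (x ^ n) (y ^ n))

module Bounded (u d c a b : ℕ) .{{_ : ℕ.NonZero d}} (d≤c : d ℕ.≤ c) (c≤u : c ℕ.≤ u)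
               (u+d≤c+c : u ℕ.+ d ℕ.≤ c ℕ.+ c) (u*d≤c*c : u ℕ.* d ℕ.≤ c ℕ.* c)
               (gain : 2 ℕ.* c ℕ.^ (a ℕ.+ b) ℕ.≤ u ℕ.^ a ℕ.* d ℕ.^ b) where
  open import Data.Nat using (_+_; _*_; _^_; _≤_; _<_)
  open ℕ.≤-Reasoning
  open ℕ-Solver.+-*-Solver using (solve; _:=_; _:+_; _:*_; con)
  open Weighted u d c d≤c u+d≤c+c u*d≤c*c

  value-powers : ∀ {n} (R : Tournament n) A B →
    value R A B ≡ u ^ arcs R A B * d ^ coarcs R A B * c ^ others R A B
  value-powers {n} R A B = trans
    (∏-cong {n} λ i → trans
      (∏-cong {n} λ j → entry-powers (lookup A i ∧ lookup B j) (i ⇒ j))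
      (∏-powers u d c (cell _∧_ i) (cell (λ α r → α ∧ not r) i) (cell (λ α _ → not α) i)))
    (∏-powers u d c (λ i → ∑ℕ (cell _∧_ i)) (λ i → ∑ℕ (cell (λ α r → α ∧ not r) i))
      (λ i → ∑ℕ (cell (λ α _ → not α) i)))
    where
    cell : (Bool → Bool → Bool) → Fin n → Fin n → ℕ
    cell π i j = ⟦ π (lookup A i ∧ lookup B j) (Tournament._⇒_ R i j) ⟧
    open Tournament R
    entry-powers : ∀ α r → entry α r ≡ u ^ ⟦ α ∧ r ⟧ * d ^ ⟦ α ∧ not r ⟧ * c ^ ⟦ not α ⟧
    entry-powers false r     = solve 1 (λ c → c := con 1 :* (c :* con 1)) refl c
    entry-powers true  true  = solve 1 (λ c → c := c :* con 1 :* con 1 :* con 1) refl u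
    entry-powers true  false = solve 1 (λ c → c := con 1 :* (c :* con 1) :* con 1) refl d

  instance
    c≢0 : ℕ.NonZero c
    c≢0 = ℕ.>-nonZero (ℕ.<-≤-trans (ℕ.>-nonZero⁻¹ d) d≤c)

  concentration : ∀ p q T M → a * T ≤ p → p + q ≤ (a + b) * T →
    u ^ p * d ^ q ≤ c ^ (p + q) * M → 2 ^ T ≤ M
  concentration p q T M aT≤p p+q≤ bound =
    ℕ.*-cancelˡ-≤ (c ^ (p + q) * d ^ q′) {{ℕ.m*n≢0 (c ^ (p + q)) (d ^ q′) {{ℕ.m^n≢0 c (p + q)}} {{ℕ.m^n≢0 d q′}}}}
      (begin
      c ^ (p + q) * d ^ q′ * 2 ^ T
        ≤⟨ ℕ.*-monoˡ-≤ (2 ^ T) (ℕ.*-monoʳ-≤ (c ^ (p + q)) (ℕ.^-monoˡ-≤ q′ d≤c)) ⟩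
      c ^ (p + q) * c ^ q′ * 2 ^ T
        ≡⟨ cong (_* 2 ^ T) (trans (sym (ℕ.^-distribˡ-+-* c (p + q) q′))
             (trans (cong (c ^_) exponents) (ℕ.^-distribˡ-+-* c p′ ((a + b) * T)))) ⟩
      c ^ p′ * c ^ ((a + b) * T) * 2 ^ T
        ≡⟨ cong (λ z → c ^ p′ * z * 2 ^ T) (ℕ.^-*-assoc c (a + b) T) ⟨
      c ^ p′ * (c ^ (a + b)) ^ T * 2 ^ T
        ≡⟨ solve 3 (λ x y z → x :* y :* z := x :* (z :* y)) refl (c ^ p′) ((c ^ (a + b)) ^ T) (2 ^ T) ⟩
      c ^ p′ * (2 ^ T * (c ^ (a + b)) ^ T)
        ≡⟨ cong (c ^ p′ *_) (^-*-distrib 2 (c ^ (a + b)) T) ⟨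
      c ^ p′ * (2 * c ^ (a + b)) ^ T
        ≤⟨ ℕ.*-mono-≤ (ℕ.^-monoˡ-≤ p′ c≤u) (ℕ.^-monoˡ-≤ T gain) ⟩
      u ^ p′ * (u ^ a * d ^ b) ^ T
        ≡⟨ cong (u ^ p′ *_) (trans (^-*-distrib (u ^ a) (d ^ b) T)
             (cong₂ _*_ (ℕ.^-*-assoc u a T) (ℕ.^-*-assoc d b T))) ⟩
      u ^ p′ * (u ^ (a * T) * d ^ (b * T))
        ≡⟨ ℕ.*-assoc (u ^ p′) (u ^ (a * T)) (d ^ (b * T)) ⟨
      u ^ p′ * u ^ (a * T) * d ^ (b * T)
        ≡⟨ cong₂ _*_ (trans (sym (ℕ.^-distribˡ-+-* u p′ (a * T))) (cong (u ^_) (ℕ.m∸n+n≡m aT≤p)))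
                     (trans (cong (d ^_) (sym q+q′)) (ℕ.^-distribˡ-+-* d q q′)) ⟩
      u ^ p * (d ^ q * d ^ q′)
        ≡⟨ ℕ.*-assoc (u ^ p) (d ^ q) (d ^ q′) ⟨
      u ^ p * d ^ q * d ^ q′
        ≤⟨ ℕ.*-monoˡ-≤ (d ^ q′) bound ⟩
      c ^ (p + q) * M * d ^ q′
        ≡⟨ solve 3 (λ x y z → x :* y :* z := x :* z :* y) refl (c ^ (p + q)) M (d ^ q′) ⟩
      c ^ (p + q) * d ^ q′ * M ∎)
    where
    p′ = p ℕ.∸ a * T
    q′ = b * T ℕ.∸ q
    q≤bT : q ≤ b * T
    q≤bT = ℕ.+-cancelˡ-≤ (a * T) q (b * T) (begin
      a * T + q      ≤⟨ ℕ.+-monoˡ-≤ q aT≤p ⟩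
      p + q          ≤⟨ p+q≤ ⟩
      (a + b) * T    ≡⟨ ℕ.*-distribʳ-+ T a b ⟩
      a * T + b * T  ∎)
    q+q′ : q + q′ ≡ b * T
    q+q′ = ℕ.m+[n∸m]≡n q≤bT
    exponents : p + q + q′ ≡ p′ + (a + b) * T
    exponents = begin-equality
      p + q + q′             ≡⟨ ℕ.+-assoc p q q′ ⟩
      p + (q + q′)           ≡⟨ cong₂ _+_ (sym (ℕ.m∸n+n≡m aT≤p)) q+q′ ⟩
      p′ + a * T + b * T     ≡⟨ solve 4 (λ p a b t → p :+ a :* t :+ b :* t
          := p :+ (a :+ b) :* t) refl p′ a b T ⟩
      p′ + (a + b) * T       ∎

  module _ (n m T L : ℕ) (n<2^L : suc n ≤ 2 ^ L)
           (m*m≡ : m * m ≡ (a + b) * T) (2mL<T : 2 * (m * L) < T) where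

    tests : List (Subset n × Subset n)
    tests = List.cartesianProduct (subsets n m) (subsets n m)

    few-tests : List.length tests < 2 ^ T
    few-tests = begin-strict
      List.length tests
        ≡⟨ length-cartesianProduct (subsets n m) (subsets n m) ⟩
      List.length (subsets n m) * List.length (subsets n m)
        ≤⟨ ℕ.*-mono-≤ few few ⟩
      2 ^ (m * L) * 2 ^ (m * L)
        ≡⟨ ℕ.^-distribˡ-+-* 2 (m * L) (m * L) ⟨
      2 ^ (m * L + m * L)
        ≡⟨ cong (λ z → 2 ^ (m * L + z)) (ℕ.+-identityʳ (m * L)) ⟨
      2 ^ (2 * (m * L))
        <⟨ ℕ.^-monoʳ-< 2 (s≤s (s≤s z≤n)) 2mL<T ⟩
      2 ^ T ∎
      where
      few : List.length (subsets n m) ≤ 2 ^ (m * L)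
      few = begin
        List.length (subsets n m)  ≤⟨ length-subsets n m ⟩
        suc n ^ m                  ≤⟨ ℕ.^-monoˡ-≤ m n<2^L ⟩
        (2 ^ L) ^ m                ≡⟨ ℕ.^-*-assoc 2 L m ⟩
        2 ^ (L * m)                ≡⟨ cong (2 ^_) (ℕ.*-comm L m) ⟩
        2 ^ (m * L)                ∎

    balanced-tournament : ∃ λ (R : Tournament n) → ∀ A B → size A ≤ m → size B ≤ m →
      arcs R A B ≤ a * T
    balanced-tournament = R , λ A B |A|≤m |B|≤m →
      ℕ.≮⇒≥ λ aT<p → ℕ.<⇒≱ few-tests
        (concentration (arcs R A B) (coarcs R A B) T (List.length tests) (ℕ.<⇒≤ aT<p)
          (begin
            arcs R A B + coarcs R A B  ≡⟨ arcs+coarcs R A B ⟩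
            size A * size B            ≤⟨ ℕ.*-mono-≤ |A|≤m |B|≤m ⟩
            m * m                      ≡⟨ m*m≡ ⟩
            (a + b) * T                ∎)
          (powers A B (∈-cartesianProduct⁺ (∈-subsets A |A|≤m) (∈-subsets B |B|≤m))))
      where
      average = tournament tests n proj₁ proj₂ (λ _ → 1)
      R = proj₁ average
      powers : ∀ A B → (A , B) ∈ tests → u ^ arcs R A B * d ^ coarcs R A B
        ≤ c ^ (arcs R A B + coarcs R A B) * List.length tests
      powers A B AB∈ = ℕ.*-cancelʳ-≤ _ _ (c ^ z) {{ℕ.m^n≢0 c z}} (begin
        u ^ p * d ^ q * c ^ z
          ≡⟨ value-powers R A B ⟨
        value R A B
          ≡⟨ ℕ.*-identityˡ (value R A B) ⟨
        1 * value R A B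
          ≤⟨ ≤total (λ t → 1 * value R (proj₁ t) (proj₂ t)) AB∈ ⟩
        Conditional.total tests (λ t → 1 * value R (proj₁ t) (proj₂ t))
          ≤⟨ proj₂ average ⟩
        Conditional.total tests (λ _ → 1) * c ^ (n * n)
          ≡⟨ cong₂ (λ x y → x * c ^ y) (total-one tests) (sym (arcs+coarcs+others R A B)) ⟩
        List.length tests * c ^ (p + q + z)
          ≡⟨ cong (List.length tests *_) (ℕ.^-distribˡ-+-* c (p + q) z) ⟩
        List.length tests * (c ^ (p + q) * c ^ z)
          ≡⟨ solve 3 (λ x y z → x :* (y :* z)
                  := y :* x :* z) refl (List.length tests) (c ^ (p + q)) (c ^ z) ⟩
        c ^ (p + q) * List.length tests * c ^ z ∎)
        where
        p = arcs R A B
        q = coarcs R A B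
        z = others R A B

-- Rounding rational weights

module _ where
  open import Data.Rational using (_+_; _*_; _-_; -_; _≤_; _<_)
  open ℚ.≤-Reasoning
  open ℚ-Solver.+-*-Solver using (solve; _:=_; _:+_; _:*_; _:-_; con)

  ι : ℕ → ℚ
  ι n = mkℚ (+ n) 0 (Coprime.sym (1-coprimeTo n))

  ι-+ : ∀ m n → ι (m ℕ.+ n) ≡ ι m + ι n
  ι-+ m n = ℚ.toℚᵘ-injective (ℚᵘ.≃-sym (ℚᵘ.≃-trans (ℚ.toℚᵘ-homo-+ (ι m) (ι n))
    (ℚᵘ.*≡* (cong (ℤ._* + 1) (cong₂ ℤ._+_ (ℤ.*-identityʳ (+ m)) (ℤ.*-identityʳ (+ n)))))))

  ι-* : ∀ m n → ι (m ℕ.* n) ≡ ι m * ι n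
  ι-* m n = ℚ.toℚᵘ-injective (ℚᵘ.≃-sym (ℚᵘ.≃-trans (ℚ.toℚᵘ-homo-* (ι m) (ι n))
    (ℚᵘ.*≡* (cong (ℤ._* + 1) (sym (ℤ.pos-* m n))))))

  ι-mono : ∀ {m n} → m ℕ.≤ n → ι m ≤ ι n
  ι-mono m≤n = *≤* (ℤ.*-monoʳ-≤-nonNeg (+ 1) (+≤+ m≤n))

  ι-cancel-< : ∀ {m n} → ι m < ι n → m ℕ.< n
  ι-cancel-< {m} {n} (*<* h) = ℤ.drop‿+<+
    (subst₂ ℤ._<_ (ℤ.*-identityʳ (+ m)) (ℤ.*-identityʳ (+ n)) h)

  0≤ι : ∀ n → 0ℚ ≤ ι n
  0≤ι n = ι-mono z≤n

  ≤-by : ∀ {p q} d → 0ℚ ≤ d → p + d ≡ q → p ≤ q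
  ≤-by {p} d 0≤d eq = subst₂ _≤_ (ℚ.+-identityʳ p) eq (ℚ.+-monoʳ-≤ p 0≤d)

  0≤+ : ∀ {p q} → 0ℚ ≤ p → 0ℚ ≤ q → 0ℚ ≤ p + q
  0≤+ = ℚ.+-mono-≤

  0≤* : ∀ {p q} → 0ℚ ≤ p → 0ℚ ≤ q → 0ℚ ≤ p * q
  0≤* {p} {q} 0≤p 0≤q = subst (_≤ p * q) (ℚ.*-zeroʳ p)
    (ℚ.*-monoˡ-≤-nonNeg p {{ℚ.nonNegative 0≤p}} 0≤q)

  0≤- : ∀ {p q} → p ≤ q → 0ℚ ≤ q - p
  0≤- {p} {q} p≤q = subst (_≤ q - p) (ℚ.+-inverseʳ p) (ℚ.+-monoˡ-≤ (- p) p≤q)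

  *-mono-≤ : ∀ {p q r s} → 0ℚ ≤ p → 0ℚ ≤ s → p ≤ q → r ≤ s → p * r ≤ q * s
  *-mono-≤ {p} {q} {r} {s} 0≤p 0≤s p≤q r≤s = ℚ.≤-trans
    (ℚ.*-monoˡ-≤-nonNeg p {{ℚ.nonNegative 0≤p}} r≤s)
    (ℚ.*-monoʳ-≤-nonNeg s {{ℚ.nonNegative 0≤s}} p≤q)

  ∑ℚ-mono : ∀ {n} {f g : Fin n → ℚ} → (∀ i → f i ≤ g i) → ∑ℚ f ≤ ∑ℚ g
  ∑ℚ-mono {zero}  h = ℚ.≤-refl
  ∑ℚ-mono {suc n} h = ℚ.+-mono-≤ (h zero) (∑ℚ-mono (h ∘ suc))

  0≤∑ℚ : ∀ {n} {f : Fin n → ℚ} → (∀ i → 0ℚ ≤ f i) → 0ℚ ≤ ∑ℚ f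
  0≤∑ℚ {zero}  h = ℚ.≤-refl
  0≤∑ℚ {suc n} h = 0≤+ (h zero) (0≤∑ℚ (h ∘ suc))

  ∑ℚ-const : ∀ n c → ∑ℚ {n} (λ _ → c) ≡ ι n * c
  ∑ℚ-const zero    c = sym (ℚ.*-zeroˡ c)
  ∑ℚ-const (suc n) c = begin-equality
    c + ∑ℚ {n} (λ _ → c)  ≡⟨ cong (_+_ c) (∑ℚ-const n c) ⟩
    c + ι n * c           ≡⟨ solve 2 (λ c n → c :+ n :* c := (con 1ℚ :+ n) :* c) refl c (ι n) ⟩
    (1ℚ + ι n) * c        ≡⟨ cong (_* c) (ι-+ 1 n) ⟨
    ι (suc n) * c         ∎

  ι-∑ : ∀ {n} (f : Fin n → ℕ) → ι (∑ℕ f) ≡ ∑ℚ (ι ∘ f)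
  ι-∑ {zero}  f = refl
  ι-∑ {suc n} f = trans (ι-+ (f zero) _) (cong (_+_ (ι (f zero))) (ι-∑ (f ∘ suc)))

  χ : Bool → ℚ
  χ b = ι ⟦ b ⟧

  v+w-1≤1 : ∀ {v w} → v ≤ 1ℚ → w ≤ 1ℚ → v + w - 1ℚ ≤ 1ℚ
  v+w-1≤1 v≤1 w≤1 = ℚ.+-monoˡ-≤ (- 1ℚ) (ℚ.+-mono-≤ v≤1 w≤1)

  -- c and v are the profit and the weight of one further, fractional vertex that is
  -- carried along: it is merged with the next vertex, and the fraction that remains is
  -- carried on.  b tells whether the last carried vertex is selected; rounding its
  -- weight up costs less than the final 1ℚ.
  round : ∀ n (f h : Fin n → ℚ) v c → 0ℚ ≤ v → v ≤ 1ℚ → 0ℚ ≤ c →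
    (∀ i → 0ℚ ≤ f i) → (∀ i → f i ≤ 1ℚ) → (∀ i → 0ℚ ≤ h i) →
    ∃ λ b → ∃ λ (A : Subset n) →
      v * c + ∑ℚ (λ i → f i * h i) ≤ χ b * c + ∑ℚ (λ i → χ (lookup A i) * h i) ×
      χ b + ∑ℚ (λ i → χ (lookup A i)) < v + ∑ℚ f + 1ℚ
  round zero f h v c 0≤v v≤1 0≤c 0≤f f≤1 0≤h with 0ℚ ℚ.<? v
  ... | yes 0<v = true , [] ,
    ℚ.+-monoˡ-≤ 0ℚ (ℚ.*-monoʳ-≤-nonNeg c {{ℚ.nonNegative 0≤c}} v≤1) ,
    ℚ.+-monoˡ-< 1ℚ (subst (0ℚ <_) (sym (ℚ.+-identityʳ v)) 0<v)
  ... | no  0≮v = false , [] ,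
    ℚ.+-monoˡ-≤ 0ℚ (ℚ.*-monoʳ-≤-nonNeg c {{ℚ.nonNegative 0≤c}} (ℚ.≮⇒≥ 0≮v)) ,
    ℚ.+-mono-≤-< (ℚ.+-monoˡ-≤ 0ℚ 0≤v) (*<* {0ℚ} {1ℚ} (+<+ (s≤s z≤n)))
  round (suc n) f h v c 0≤v v≤1 0≤c 0≤f f≤1 0≤h
    with ℚ.≤-total (v + f zero) 1ℚ | ℚ.≤-total (h zero) c
  ... | inj₁ v+w≤1 | inj₁ z≤c =
    let w = f zero
        z = h zero
        S = ∑ℚ (λ i → f (suc i) * h (suc i))
        b , A , value , mass = round n (f ∘ suc) (h ∘ suc) (v + w) c
          (0≤+ 0≤v (0≤f zero)) v+w≤1 0≤c (0≤f ∘ suc) (f≤1 ∘ suc) (0≤h ∘ suc)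
        D = ∑ℚ (λ i → χ (lookup A i) * h (suc i))
        K = ∑ℚ (λ i → χ (lookup A i))
    in b , false ∷ A ,
    (begin
      v * c + (w * z + S)
        ≤⟨ ≤-by (w * (c - z)) (0≤* (0≤f zero) (0≤- z≤c))
             (solve 5 (λ v c w z S → v :* c :+ (w :* z :+ S) :+ w :* (c :- z)
                 := (v :+ w) :* c :+ S) refl v c w z S) ⟩
      (v + w) * c + S
        ≤⟨ value ⟩
      χ b * c + D
        ≡⟨ solve 4 (λ b c z D → b :* c :+ D := b :* c :+ (con 0ℚ :* z :+ D)) refl (χ b) c z D ⟩
      χ b * c + (0ℚ * z + D) ∎) ,
    subst₂ _<_ (solve 2 (λ b K → b :+ K := b :+ (con 0ℚ :+ K)) refl (χ b) K)
      (solve 3 (λ v w F → v :+ w :+ F :+ con 1ℚ := v :+ (w :+ F) :+ con 1ℚ) refl v w (∑ℚ (f ∘ suc))) mass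
  ... | inj₁ v+w≤1 | inj₂ c≤z =
    let w = f zero
        z = h zero
        S = ∑ℚ (λ i → f (suc i) * h (suc i))
        b , A , value , mass = round n (f ∘ suc) (h ∘ suc) (v + w) z
          (0≤+ 0≤v (0≤f zero)) v+w≤1 (0≤h zero) (0≤f ∘ suc) (f≤1 ∘ suc) (0≤h ∘ suc)
        D = ∑ℚ (λ i → χ (lookup A i) * h (suc i))
        K = ∑ℚ (λ i → χ (lookup A i))
    in false , b ∷ A ,
    (begin
      v * c + (w * z + S)
        ≤⟨ ≤-by (v * (z - c)) (0≤* 0≤v (0≤- c≤z))
             (solve 5 (λ v c w z S → v :* c :+ (w :* z :+ S) :+ v :* (z :- c)
                 := (v :+ w) :* z :+ S) refl v c w z S) ⟩
      (v + w) * z + S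
        ≤⟨ value ⟩
      χ b * z + D
        ≡⟨ solve 4 (λ b c z D → b :* z :+ D := con 0ℚ :* c :+ (b :* z :+ D)) refl (χ b) c z D ⟩
      0ℚ * c + (χ b * z + D) ∎) ,
    subst₂ _<_ (solve 2 (λ b K → b :+ K := con 0ℚ :+ (b :+ K)) refl (χ b) K)
      (solve 3 (λ v w F → v :+ w :+ F :+ con 1ℚ := v :+ (w :+ F) :+ con 1ℚ) refl v w (∑ℚ (f ∘ suc))) mass
  ... | inj₂ 1≤v+w | inj₁ z≤c =
    let w = f zero
        z = h zero
        S = ∑ℚ (λ i → f (suc i) * h (suc i))
        b , A , value , mass = round n (f ∘ suc) (h ∘ suc) (v + w - 1ℚ) z
          (0≤- 1≤v+w) (v+w-1≤1 v≤1 (f≤1 zero)) (0≤h zero) (0≤f ∘ suc) (f≤1 ∘ suc) (0≤h ∘ suc)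
        D = ∑ℚ (λ i → χ (lookup A i) * h (suc i))
        K = ∑ℚ (λ i → χ (lookup A i))
    in true , b ∷ A ,
    (begin
      v * c + (w * z + S)
        ≤⟨ ≤-by ((1ℚ - v) * (c - z)) (0≤* (0≤- v≤1) (0≤- z≤c))
             (solve 5 (λ v c w z S → v :* c :+ (w :* z :+ S) :+ (con 1ℚ :- v) :* (c :- z)
                 := con 1ℚ :* c :+ ((v :+ w :- con 1ℚ) :* z :+ S)) refl v c w z S) ⟩
      1ℚ * c + ((v + w - 1ℚ) * z + S)
        ≤⟨ ℚ.+-monoʳ-≤ (1ℚ * c) value ⟩
      1ℚ * c + (χ b * z + D) ∎) ,
    subst (1ℚ + (χ b + K) <_)
      (solve 3 (λ v w F → con 1ℚ :+ (v :+ w :- con 1ℚ :+ F :+ con 1ℚ)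
          := v :+ (w :+ F) :+ con 1ℚ) refl v w (∑ℚ (f ∘ suc)))
      (ℚ.+-monoʳ-< 1ℚ mass)
  ... | inj₂ 1≤v+w | inj₂ c≤z =
    let w = f zero
        z = h zero
        S = ∑ℚ (λ i → f (suc i) * h (suc i))
        b , A , value , mass = round n (f ∘ suc) (h ∘ suc) (v + w - 1ℚ) c
          (0≤- 1≤v+w) (v+w-1≤1 v≤1 (f≤1 zero)) 0≤c (0≤f ∘ suc) (f≤1 ∘ suc) (0≤h ∘ suc)
        D = ∑ℚ (λ i → χ (lookup A i) * h (suc i))
        K = ∑ℚ (λ i → χ (lookup A i))
    in b , true ∷ A ,
    (begin
      v * c + (w * z + S)
        ≤⟨ ≤-by ((1ℚ - w) * (z - c)) (0≤* (0≤- (f≤1 zero)) (0≤- c≤z))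
             (solve 5 (λ v c w z S → v :* c :+ (w :* z :+ S) :+ (con 1ℚ :- w) :* (z :- c)
                 := con 1ℚ :* z :+ ((v :+ w :- con 1ℚ) :* c :+ S)) refl v c w z S) ⟩
      1ℚ * z + ((v + w - 1ℚ) * c + S)
        ≤⟨ ℚ.+-monoʳ-≤ (1ℚ * z) value ⟩
      1ℚ * z + (χ b * c + D)
        ≡⟨ solve 3 (λ p q r → p :+ (q :+ r) := q :+ (p :+ r)) refl (1ℚ * z) (χ b * c) D ⟩
      χ b * c + (1ℚ * z + D) ∎) ,
    subst₂ _<_ (solve 2 (λ b K → con 1ℚ :+ (b :+ K) := b :+ (con 1ℚ :+ K)) refl (χ b) K)
      (solve 3 (λ v w F → con 1ℚ :+ (v :+ w :- con 1ℚ :+ F :+ con 1ℚ)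
          := v :+ (w :+ F) :+ con 1ℚ) refl v w (∑ℚ (f ∘ suc)))
      (ℚ.+-monoʳ-< 1ℚ mass)

  select : ∀ {n} (f h : Fin n → ℚ) m →
    (∀ i → 0ℚ ≤ f i) → (∀ i → f i ≤ 1ℚ) → (∀ i → 0ℚ ≤ h i) →
    ∑ℚ f ≤ ι m → ∃ λ A → size A ℕ.≤ m ×
      ∑ℚ (λ i → f i * h i) ≤ ∑ℚ (λ i → χ (lookup A i) * h i)
  select {n} f h m 0≤f f≤1 0≤h Σf≤m =
    let b , A , value , mass = round n f h 0ℚ 0ℚ ℚ.≤-refl (*≤* (+≤+ z≤n)) ℚ.≤-refl 0≤f f≤1 0≤h
        D = ∑ℚ (λ i → χ (lookup A i) * h i)
    in A , ℕ.≤-pred (ι-cancel-< (begin-strict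
      ι (size A)
        ≡⟨ ι-∑ (λ i → ⟦ lookup A i ⟧) ⟩
      ∑ℚ (λ i → χ (lookup A i))
        ≤⟨ ≤-by (χ b) (0≤ι ⟦ b ⟧) (ℚ.+-comm (∑ℚ λ i → χ (lookup A i)) (χ b)) ⟩
      χ b + ∑ℚ (λ i → χ (lookup A i))
        <⟨ mass ⟩
      0ℚ + ∑ℚ f + 1ℚ
        ≤⟨ ℚ.+-monoˡ-≤ 1ℚ (subst (_≤ ι m) (sym (ℚ.+-identityˡ (∑ℚ f))) Σf≤m) ⟩
      ι m + 1ℚ
        ≡⟨ trans (ℚ.+-comm (ι m) 1ℚ) (sym (ι-+ 1 m)) ⟩
      ι (suc m) ∎)) , (begin
      ∑ℚ (λ i → f i * h i)
        ≡⟨ ℚ.+-identityˡ (∑ℚ (λ i → f i * h i)) ⟨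
      0ℚ * 0ℚ + ∑ℚ (λ i → f i * h i)
        ≤⟨ value ⟩
      χ b * 0ℚ + D
        ≡⟨ solve 2 (λ b D → b :* con 0ℚ :+ D := D) refl (χ b) D ⟩
      D ∎)

  arcSum : ∀ {n} → Tournament n → (Fin n → Fin n → ℚ) → ℚ
  arcSum R h = ∑ℚ λ i → ∑ℚ λ j → if i ⇒ j then h i j else 0ℚ
    where open Tournament R

  module _ {n} (R : Tournament n) (m : ℕ) (γ : ℚ)
           (balanced : ∀ A B → size A ℕ.≤ m → size B ℕ.≤ m → ι (arcs R A B) ≤ γ * (ι m * ι m)) where
    open Tournament R

    private
      ρ : Fin n → Fin n → ℚ
      ρ i j = χ (i ⇒ j)

      if-χ : ∀ b p → (if b then p else 0ℚ) ≡ χ b * p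
      if-χ false p = sym (ℚ.*-zeroˡ p)
      if-χ true  p = sym (ℚ.*-identityˡ p)

      χ-∧ : ∀ a b r → χ a * (χ r * χ b) ≡ χ ((a ∧ b) ∧ r)
      χ-∧ false b     r = ℚ.*-zeroˡ (χ r * χ b)
      χ-∧ true  false r = trans (ℚ.*-identityˡ _) (ℚ.*-zeroʳ (χ r))
      χ-∧ true  true  r = trans (ℚ.*-identityˡ _) (ℚ.*-identityʳ (χ r))

      pull : ∀ (f g : Fin n → ℚ) →
        ∑ℚ (λ i → ∑ℚ λ j → f i * (ρ i j * g j)) ≡ ∑ℚ (λ i → f i * ∑ℚ λ j → ρ i j * g j)
      pull f g = ∑ℚ-cong {n} λ i → sym (*-∑ℚ {n} (f i) λ j → ρ i j * g j)

      pull′ : ∀ (f g : Fin n → ℚ) →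
        ∑ℚ (λ i → ∑ℚ λ j → f i * (ρ i j * g j)) ≡ ∑ℚ (λ j → g j * ∑ℚ λ i → ρ i j * f i)
      pull′ f g = trans (∑ℚ-comm {n} {n} λ i j → f i * (ρ i j * g j))
        (∑ℚ-cong {n} λ j → trans
          (∑ℚ-cong {n} λ i → solve 3 (λ f r g → f :* (r :* g) := g :* (r :* f)) refl (f i) (ρ i j) (g j))
          (sym (*-∑ℚ {n} (g j) λ i → ρ i j * f i)))

      arcSum-ρ : ∀ (f g : Fin n → ℚ) →
        arcSum R (λ i j → f i * g j) ≡ ∑ℚ (λ i → ∑ℚ λ j → f i * (ρ i j * g j))
      arcSum-ρ f g = ∑ℚ-cong {n} λ i → ∑ℚ-cong {n} λ j → trans (if-χ (i ⇒ j) (f i * g j))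
        (solve 3 (λ f r g → r :* (f :* g) := f :* (r :* g)) refl (f i) (ρ i j) (g j))

    arcSum-≤-unit : ∀ (f g : Fin n → ℚ) →
      (∀ i → 0ℚ ≤ f i) → (∀ i → f i ≤ 1ℚ) → (∀ i → 0ℚ ≤ g i) → (∀ i → g i ≤ 1ℚ) →
      ∑ℚ f ≤ ι m → ∑ℚ g ≤ ι m → arcSum R (λ i j → f i * g j) ≤ γ * (ι m * ι m)
    arcSum-≤-unit f g 0≤f f≤1 0≤g g≤1 Σf≤m Σg≤m =
      let A , |A|≤m , f≤A = select f (λ i → ∑ℚ λ j → ρ i j * g j) m 0≤f f≤1
            (λ i → 0≤∑ℚ λ j → 0≤* (0≤ι ⟦ i ⇒ j ⟧) (0≤g j)) Σf≤m
          a = λ i → χ (lookup A i)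
          B , |B|≤m , g≤B = select g (λ j → ∑ℚ λ i → ρ i j * a i) m 0≤g g≤1
            (λ j → 0≤∑ℚ λ i → 0≤* (0≤ι ⟦ i ⇒ j ⟧) (0≤ι ⟦ lookup A i ⟧)) Σg≤m
          b = λ j → χ (lookup B j)
      in begin
      arcSum R (λ i j → f i * g j)
        ≡⟨ trans (arcSum-ρ f g) (pull f g) ⟩
      ∑ℚ (λ i → f i * ∑ℚ λ j → ρ i j * g j)
        ≤⟨ f≤A ⟩
      ∑ℚ (λ i → a i * ∑ℚ λ j → ρ i j * g j)
        ≡⟨ trans (sym (pull a g)) (pull′ a g) ⟩
      ∑ℚ (λ j → g j * ∑ℚ λ i → ρ i j * a i)
        ≤⟨ g≤B ⟩
      ∑ℚ (λ j → b j * ∑ℚ λ i → ρ i j * a i)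
        ≡⟨ pull′ a b ⟨
      ∑ℚ (λ i → ∑ℚ λ j → a i * (ρ i j * b j))
        ≡⟨ ∑ℚ-cong {n} (λ i → trans (∑ℚ-cong {n} λ j → χ-∧ (lookup A i) (lookup B j) (i ⇒ j))
             (sym (ι-∑ {n} λ j → ⟦ (lookup A i ∧ lookup B j) ∧ (i ⇒ j) ⟧))) ⟩
      ∑ℚ (λ i → ι (∑ℕ λ j → ⟦ (lookup A i ∧ lookup B j) ∧ (i ⇒ j) ⟧))
        ≡⟨ ι-∑ {n} (λ i → ∑ℕ λ j → ⟦ (lookup A i ∧ lookup B j) ∧ (i ⇒ j) ⟧) ⟨
      ι (arcs R A B)
        ≤⟨ balanced A B |A|≤m |B|≤m ⟩
      γ * (ι m * ι m) ∎

    arcSum-scale : ∀ s t (f g : Fin n → ℚ) →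
      arcSum R (λ i j → s * f i * (t * g j)) ≡ s * t * arcSum R (λ i j → f i * g j)
    arcSum-scale s t f g = trans
      (∑ℚ-cong {n} λ i → trans (∑ℚ-cong {n} λ j → scaled (i ⇒ j) (f i) (g j))
        (sym (*-∑ℚ {n} (s * t) λ j → if i ⇒ j then f i * g j else 0ℚ)))
      (sym (*-∑ℚ {n} (s * t) λ i → ∑ℚ λ j → if i ⇒ j then f i * g j else 0ℚ))
      where
      scaled : ∀ b p q → (if b then s * p * (t * q) else 0ℚ) ≡ s * t * (if b then p * q else 0ℚ)
      scaled false p q = sym (ℚ.*-zeroʳ (s * t))
      scaled true  p q = solve 4 (λ s t p q → s :* p :* (t :* q) := s :* t :* (p :* q)) refl s t p q

    module Scaled {{m>0 : ℕ.NonZero m}} where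

      record Shrink (f : Fin n → ℚ) (P : ℚ) : Set where
        field
          factor   : ℚ
          0<factor : 0ℚ < factor
          scales   : factor * P ≡ ι m
          0≤shrunk : ∀ i → 0ℚ ≤ factor * f i
          shrunk≤1 : ∀ i → factor * f i ≤ 1ℚ
          mass     : ∑ℚ (λ i → factor * f i) ≤ ι m

      shrink : ∀ (f : Fin n → ℚ) P → (∀ i → 0ℚ ≤ f i) → (∀ i → f i ≤ ι 2) →
        ι (2 ℕ.* m) ≤ P → ∑ℚ f ≤ P → Shrink f P
      shrink f P 0≤f f≤2 2m≤P Σf≤P = record
        { factor   = s
        ; 0<factor = 0<s
        ; scales   = sP≡m
        ; 0≤shrunk = λ i → 0≤* (ℚ.<⇒≤ 0<s) (0≤f i)
        ; shrunk≤1 = λ i → begin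
            s * f i                 ≤⟨ ℚ.*-monoˡ-≤-nonNeg s {{ℚ.nonNegative (ℚ.<⇒≤ 0<s)}} (f≤2 i) ⟩
            ι m * r * ι 2           ≡⟨ solve 3 (λ m r t → m :* r :* t
                := t :* m :* r) refl (ι m) r (ι 2) ⟩
            ι 2 * ι m * r           ≡⟨ cong (_* r) (ι-* 2 m) ⟨
            ι (2 ℕ.* m) * r         ≤⟨ ℚ.*-monoʳ-≤-nonNeg r {{ℚ.nonNegative (ℚ.<⇒≤ 0<r)}} 2m≤P ⟩
            P * r                   ≡⟨ ℚ.*-inverseʳ P ⟩
            1ℚ                      ∎
        ; mass     = begin
            ∑ℚ (λ i → s * f i)      ≡⟨ *-∑ℚ {n} s f ⟨
            s * ∑ℚ f                ≤⟨ ℚ.*-monoˡ-≤-nonNeg s {{ℚ.nonNegative (ℚ.<⇒≤ 0<s)}} Σf≤P ⟩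
            s * P                   ≡⟨ sP≡m ⟩
            ι m                     ∎
        }
        where
        0<m : 0ℚ < ι m
        0<m = *<* (subst₂ ℤ._<_ (sym (ℤ.*-zeroˡ (+ 1)))
          (sym (ℤ.*-identityʳ (+ m))) (+<+ (ℕ.>-nonZero⁻¹ m)))
        0<P : 0ℚ < P
        0<P = ℚ.<-≤-trans 0<m (ℚ.≤-trans (ι-mono (ℕ.m≤m+n m _)) 2m≤P)
        instance
          P-pos : ℚ.Positive P
          P-pos = ℚ.positive 0<P
          P-nonZero : ℚ.NonZero P
          P-nonZero = ℚ.pos⇒nonZero P
        r = ℚ.1/ P
        0<r : 0ℚ < r
        0<r = ℚ.positive⁻¹ r {{ℚ.1/pos⇒pos P}}
        s = ι m * r
        0<s : 0ℚ < s
        0<s = subst (_< s) (ℚ.*-zeroˡ r) (ℚ.*-monoˡ-<-pos r {{ℚ.1/pos⇒pos P}} 0<m)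
        sP≡m : s * P ≡ ι m
        sP≡m = trans (ℚ.*-assoc (ι m) r P)
          (trans (cong (ι m *_) (ℚ.*-inverseˡ P)) (ℚ.*-identityʳ (ι m)))

      arcSum-≤ : ∀ (f g : Fin n → ℚ) P Q →
        (∀ i → 0ℚ ≤ f i) → (∀ i → f i ≤ ι 2) → (∀ i → 0ℚ ≤ g i) → (∀ i → g i ≤ ι 2) →
        ι (2 ℕ.* m) ≤ P → ι (2 ℕ.* m) ≤ Q → ∑ℚ f ≤ P → ∑ℚ g ≤ Q →
        arcSum R (λ i j → f i * g j) ≤ γ * (P * Q)
      arcSum-≤ f g P Q 0≤f f≤2 0≤g g≤2 2m≤P 2m≤Q Σf≤P Σg≤Q =
        ℚ.*-cancelˡ-≤-pos (s * t) {{ℚ.positive (subst (_< s * t) (ℚ.*-zeroˡ t)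
          (ℚ.*-monoˡ-<-pos t {{ℚ.positive G.0<factor}} F.0<factor))}} (begin
          s * t * arcSum R (λ i j → f i * g j)
            ≡⟨ arcSum-scale s t f g ⟨
          arcSum R (λ i j → s * f i * (t * g j))
            ≤⟨ arcSum-≤-unit _ _ F.0≤shrunk F.shrunk≤1 G.0≤shrunk G.shrunk≤1 F.mass G.mass ⟩
          γ * (ι m * ι m)
            ≡⟨ cong₂ (λ x y → γ * (x * y)) F.scales G.scales ⟨
          γ * (s * P * (t * Q))
            ≡⟨ solve 5 (λ γ s P t Q → γ :* (s :* P :* (t :* Q))
                    := s :* t :* (γ :* (P :* Q))) refl γ s P t Q ⟩
          s * t * (γ * (P * Q)) ∎)
        where
        module F = Shrink (shrink f P 0≤f f≤2 2m≤P Σf≤P)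
        module G = Shrink (shrink g Q 0≤g g≤2 2m≤Q Σg≤Q)
        s = F.factor
        t = G.factor

module Balanced (u d c a b : ℕ) .{{_ : ℕ.NonZero d}} (d≤c : d ℕ.≤ c) (c≤u : c ℕ.≤ u)
                (u+d≤c+c : u ℕ.+ d ℕ.≤ c ℕ.+ c) (u*d≤c*c : u ℕ.* d ℕ.≤ c ℕ.* c)
                (gain : 2 ℕ.* c ℕ.^ (a ℕ.+ b) ℕ.≤ u ℕ.^ a ℕ.* d ℕ.^ b)
                (γ : ℚ) (γ-def : γ ℚ.* ι (a ℕ.+ b) ≡ ι a)
                (s t : ℕ) (s*s≡ : s ℕ.* s ≡ (a ℕ.+ b) ℕ.* t) (2s<t : 2 ℕ.* s ℕ.< t) where

  balanced : ∀ n L .{{_ : ℕ.NonZero L}} → suc n ℕ.≤ 2 ℕ.^ L →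
    ∃ λ (R : Tournament n) → ∀ A B → size A ℕ.≤ L ℕ.* s → size B ℕ.≤ L ℕ.* s →
      ι (arcs R A B) ℚ.≤ γ ℚ.* (ι (L ℕ.* s) ℚ.* ι (L ℕ.* s))
  balanced n L n<2^L = proj₁ T , λ A B hA hB → begin
      ι (arcs (proj₁ T) A B)              ≤⟨ ι-mono (proj₂ T A B hA hB) ⟩
      ι (a ℕ.* (L ℕ.* L ℕ.* t))           ≡⟨ ι-* a (L ℕ.* L ℕ.* t) ⟩
      ι a ℚ.* ι (L ℕ.* L ℕ.* t)           ≡⟨ cong (ℚ._* ι (L ℕ.* L ℕ.* t)) γ-def ⟨
      γ ℚ.* ι (a ℕ.+ b) ℚ.* ι (L ℕ.* L ℕ.* t)
        ≡⟨ ℚ.*-assoc γ (ι (a ℕ.+ b)) (ι (L ℕ.* L ℕ.* t)) ⟩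
      γ ℚ.* (ι (a ℕ.+ b) ℚ.* ι (L ℕ.* L ℕ.* t))
        ≡⟨ cong (γ ℚ.*_) (trans (sym (ι-* (a ℕ.+ b) (L ℕ.* L ℕ.* t)))
             (trans (cong ι (sym square)) (ι-* (L ℕ.* s) (L ℕ.* s)))) ⟩
      γ ℚ.* (ι (L ℕ.* s) ℚ.* ι (L ℕ.* s)) ∎
    where
    open ℚ.≤-Reasoning
    open ℕ-Solver.+-*-Solver using (solve; _:=_; _:*_; con)
    square : L ℕ.* s ℕ.* (L ℕ.* s) ≡ (a ℕ.+ b) ℕ.* (L ℕ.* L ℕ.* t)
    square = trans (solve 2 (λ L s → L :* s :* (L :* s) := L :* L :* (s :* s)) refl L s)
      (trans (cong (L ℕ.* L ℕ.*_) s*s≡)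
        (solve 3 (λ L c t → L :* L :* (c :* t) := c :* (L :* L :* t)) refl L (a ℕ.+ b) t))
    enough : 2 ℕ.* (L ℕ.* s ℕ.* L) ℕ.< L ℕ.* L ℕ.* t
    enough = subst (ℕ._< L ℕ.* L ℕ.* t)
      (solve 2 (λ L s → L :* L :* (con 2 :* s) := con 2 :* (L :* s :* L)) refl L s)
      (ℕ.*-monoʳ-< (L ℕ.* L) {{ℕ.m*n≢0 L L}} 2s<t)
    T = Bounded.balanced-tournament u d c a b d≤c c≤u u+d≤c+c u*d≤c*c gain
          n (L ℕ.* s) (L ℕ.* L ℕ.* t) L n<2^L square enough

-- Logarithms and the rational form of the bound

module _ where
  open import Data.Nat using (_+_; _*_; _^_; _≤_; _<_)
  open ℕ.≤-Reasoning
  open ℕ-Solver.+-*-Solver using (solve; _:=_; _:+_; _:*_; con)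

  *-double : ∀ a b → a * (2 * b) ≡ (a + a) * b
  *-double = solve 2 (λ a b → a :* (con 2 :* b) := (a :+ a) :* b) refl

  four-times : ∀ l s → 2 * (suc (suc l) * s) + 2 * (suc (suc l) * s) ≤ suc l * (8 * s)
  four-times l s = ℕ.≤-trans (ℕ.m≤m+n _ (l * s * 4)) (ℕ.≤-reflexive
    (solve 2 (λ l s → con 2 :* ((con 2 :+ l) :* s) :+ con 2 :* ((con 2 :+ l) :* s) :+ l :* s :* con 4
      := (con 1 :+ l) :* (con 8 :* s)) refl l s))

  log₂ : ∀ k → ∃ λ l → 2 ^ suc l ≤ suc (suc k) × suc (suc k) < 2 ^ suc (suc l)
  log₂ zero    = 0 , ℕ.≤-refl , s≤s (s≤s (s≤s z≤n))
  log₂ (suc k) with log₂ k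
  ... | l , 2^l≤k , k<2^1+l with suc (suc (suc k)) ℕ.<? 2 ^ suc (suc l)
  ...   | yes 1+k<2^1+l = l , ℕ.m≤n⇒m≤1+n 2^l≤k , 1+k<2^1+l
  ...   | no  1+k≮2^1+l = suc l , ℕ.≮⇒≥ 1+k≮2^1+l , (begin-strict
    suc (suc (suc k))    ≤⟨ k<2^1+l ⟩
    2 ^ suc (suc l)      <⟨ ℕ.^-monoʳ-< 2 ℕ.≤-refl (ℕ.n<1+n (suc (suc l))) ⟩
    2 ^ suc (suc (suc l)) ∎)

module _ where
  open import Data.Rational using (_+_; _*_; _-_; _≤_)
  open ℚ.≤-Reasoning
  open ℚ-Solver.+-*-Solver using (solve; _:=_; _:+_; _:*_; _:-_; con)

  0≤1/suc : ∀ n → 0ℚ ≤ 1/suc n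
  0≤1/suc n = *≤* (+≤+ z≤n)

  1/suc-anti-≤ : ∀ {m n} → m ℕ.≤ n → 1/suc n ≤ 1/suc m
  1/suc-anti-≤ m≤n = *≤* (+≤+ (ℕ.*-monoʳ-≤ 1 (s≤s m≤n)))

  ι*1/suc : ∀ n → ι (suc n) * 1/suc n ≡ 1ℚ
  ι*1/suc n = ℚ.toℚᵘ-injective (ℚᵘ.≃-trans (ℚ.toℚᵘ-homo-* (ι (suc n)) (1/suc n))
    (ℚᵘ.*≡* (trans (ℤ.*-identityʳ _) (trans (ℤ.*-identityʳ _)
      (sym (trans (ℤ.*-identityˡ _) (cong +_ (ℕ.+-identityʳ (suc n)))))))))

  0≤harmonic : ∀ a l → 0ℚ ≤ harmonic a l
  0≤harmonic a zero    = ℚ.≤-refl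
  0≤harmonic a (suc l) = 0≤+ (0≤harmonic a l) (0≤1/suc (a ℕ.+ l))

  harmonic-split : ∀ a l l′ → harmonic a (l ℕ.+ l′) ≡ harmonic a l + harmonic (a ℕ.+ l) l′
  harmonic-split a l zero     = trans (cong (harmonic a) (ℕ.+-identityʳ l)) (sym (ℚ.+-identityʳ _))
  harmonic-split a l (suc l′) = begin-equality
    harmonic a (l ℕ.+ suc l′)
      ≡⟨ cong (harmonic a) (ℕ.+-suc l l′) ⟩
    harmonic a (l ℕ.+ l′) + 1/suc (a ℕ.+ (l ℕ.+ l′))
      ≡⟨ cong₂ (λ p n → p + 1/suc n) (harmonic-split a l l′) (sym (ℕ.+-assoc a l l′)) ⟩
    harmonic a l + harmonic (a ℕ.+ l) l′ + 1/suc (a ℕ.+ l ℕ.+ l′)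
      ≡⟨ ℚ.+-assoc (harmonic a l) (harmonic (a ℕ.+ l) l′) _ ⟩
    harmonic a l + harmonic (a ℕ.+ l) (suc l′) ∎

  harmonic-≥ : ∀ a l b → a ℕ.+ l ℕ.≤ suc b → ι l * 1/suc b ≤ harmonic a l
  harmonic-≥ a zero    b h = ℚ.≤-reflexive (ℚ.*-zeroˡ (1/suc b))
  harmonic-≥ a (suc l) b h = begin
    ι (suc l) * 1/suc b          ≡⟨ cong (_* 1/suc b) (trans (ι-+ 1 l) (ℚ.+-comm 1ℚ (ι l))) ⟩
    (ι l + 1ℚ) * 1/suc b         ≡⟨ solve 2 (λ l r → (l :+ con 1ℚ) :* r
        := l :* r :+ r) refl (ι l) (1/suc b) ⟩
    ι l * 1/suc b + 1/suc b      ≤⟨ ℚ.+-mono-≤ (harmonic-≥ a l b (ℕ.m≤n⇒m≤1+n a+l≤b))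
                                      (1/suc-anti-≤ a+l≤b) ⟩
    harmonic a (suc l)           ∎
    where
    a+l≤b : a ℕ.+ l ℕ.≤ b
    a+l≤b = ℕ.≤-pred (subst (ℕ._≤ suc b) (ℕ.+-suc a l) h)

  harmonic-double : ∀ a → ½ ≤ harmonic (suc a) (suc a)
  harmonic-double a = begin
    ½                              ≡⟨ ℚ.*-identityʳ ½ ⟨
    ½ * 1ℚ                         ≡⟨ cong (½ *_) (ι*1/suc c) ⟨
    ½ * (ι (suc a ℕ.+ suc a) * r)  ≡⟨ cong (λ p → ½ * (p * r)) (ι-+ (suc a) (suc a)) ⟩
    ½ * ((ι (suc a) + ι (suc a)) * r)
      ≡⟨ solve 2 (λ p r → con ½ :* ((p :+ p) :* r) := p :* r) refl (ι (suc a)) r ⟩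
    ι (suc a) * r                  ≤⟨ harmonic-≥ (suc a) (suc a) c ℕ.≤-refl ⟩
    harmonic (suc a) (suc a)       ∎
    where
    c = a ℕ.+ suc a
    r = 1/suc c

  harmonic-log : ∀ l a s → suc a ℕ.* 2 ℕ.^ l ℕ.≤ suc a ℕ.+ s → ι l * ½ ≤ harmonic (suc a) s
  harmonic-log zero    a s _ = 0≤harmonic (suc a) s
  harmonic-log (suc l) a s h = begin
    ι (suc l) * ½                  ≡⟨ cong (_* ½) (ι-+ 1 l) ⟩
    (1ℚ + ι l) * ½                 ≡⟨ solve 1 (λ l → (con 1ℚ :+ l) :* con ½
        := con ½ :+ l :* con ½) refl (ι l) ⟩
    ½ + ι l * ½                    ≤⟨ ℚ.+-mono-≤ (harmonic-double a) (harmonic-log l (a ℕ.+ suc a) r h′) ⟩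
    harmonic A A + harmonic (A ℕ.+ A) r
                                   ≡⟨ harmonic-split A A r ⟨
    harmonic A (A ℕ.+ r)           ≡⟨ cong (harmonic A) A+r≡s ⟩
    harmonic A s                   ∎
    where
    A = suc a
    r = s ℕ.∸ A
    double : A ℕ.* 2 ℕ.^ suc l ≡ (A ℕ.+ A) ℕ.* 2 ℕ.^ l
    double = *-double A (2 ℕ.^ l)
    A≤s : A ℕ.≤ s
    A≤s = ℕ.+-cancelˡ-≤ A A s (ℕ.≤-trans
      (ℕ.m≤m*n (A ℕ.+ A) (2 ℕ.^ l) {{ℕ.m^n≢0 2 l}})
      (ℕ.≤-trans (ℕ.≤-reflexive (sym double)) h))
    A+r≡s : A ℕ.+ r ≡ s
    A+r≡s = ℕ.m+[n∸m]≡n A≤s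
    h′ : (A ℕ.+ A) ℕ.* 2 ℕ.^ l ℕ.≤ A ℕ.+ A ℕ.+ r
    h′ = subst₂ ℕ._≤_ double (trans (cong (A ℕ.+_) (sym A+r≡s)) (sym (ℕ.+-assoc A A r))) h

  logSeq-≥ : ∀ k l n → 2 ℕ.^ l ℕ.≤ suc k → ι l * ½ ≤ logSeq (suc k) n
  logSeq-≥ k l n 2^l≤k = harmonic-log l n (k ℕ.* suc n)
    (ℕ.≤-trans (ℕ.*-monoʳ-≤ (suc n) 2^l≤k) (ℕ.≤-reflexive (ℕ.*-comm (suc n) (suc k))))

  *-≤-square : ∀ {P Q Y} → 0ℚ ≤ P → 0ℚ ≤ Q → P + Q ≤ Y + Y → P * Q ≤ Y * Y
  *-≤-square {P} {Q} {Y} 0≤P 0≤Q P+Q≤2Y = begin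
    P * Q
      ≤⟨ ≤-by ((½ * (P - Q)) * (½ * (P - Q))) (0≤square (½ * (P - Q)))
           (solve 2 (λ P Q → P :* Q :+ (con ½ :* (P :- Q)) :* (con ½ :* (P :- Q))
               := (con ½ :* (P :+ Q)) :* (con ½ :* (P :+ Q))) refl P Q) ⟩
    (½ * (P + Q)) * (½ * (P + Q))
      ≤⟨ *-mono-≤ 0≤Z (ℚ.≤-trans 0≤Z Z≤Y) Z≤Y Z≤Y ⟩
    Y * Y ∎
    where
    0≤½ : 0ℚ ≤ ½
    0≤½ = *≤* (+≤+ z≤n)
    0≤Z : 0ℚ ≤ ½ * (P + Q)
    0≤Z = 0≤* 0≤½ (0≤+ 0≤P 0≤Q)
    Z≤Y : ½ * (P + Q) ≤ Y
    Z≤Y = ℚ.≤-trans (ℚ.*-monoˡ-≤-nonNeg ½ P+Q≤2Y)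
      (ℚ.≤-reflexive (solve 1 (λ Y → con ½ :* (Y :+ Y) := Y) refl Y))
    0≤square : ∀ p → 0ℚ ≤ p * p
    0≤square p with ℚ.≤-total 0ℚ p
    ... | inj₁ 0≤p = 0≤* 0≤p 0≤p
    ... | inj₂ p≤0 = subst (0ℚ ≤_)
      (solve 1 (λ p → (con 0ℚ :- p) :* (con 0ℚ :- p) := p :* p) refl p)
      (0≤* (0≤- p≤0) (0≤- p≤0))

  *-≤-square′ : ∀ {D Q Y} → 0ℚ ≤ D → D + D ≤ Y → Q ≤ Y + Y → D * Q ≤ Y * Y
  *-≤-square′ {D} {Q} {Y} 0≤D 2D≤Y Q≤2Y = begin
    D * Q        ≤⟨ ℚ.*-monoˡ-≤-nonNeg D {{ℚ.nonNegative 0≤D}} Q≤2Y ⟩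
    D * (Y + Y)  ≡⟨ solve 2 (λ D Y → D :* (Y :+ Y) := (D :+ D) :* Y) refl D Y ⟩
    (D + D) * Y  ≤⟨ ℚ.*-monoʳ-≤-nonNeg Y {{ℚ.nonNegative (ℚ.≤-trans (0≤+ 0≤D 0≤D) 2D≤Y)}} 2D≤Y ⟩
    Y * Y        ∎

  ⊔-*-⊔-≤-square : ∀ {F G D Y} →
    0ℚ ≤ F → 0ℚ ≤ G → 0ℚ ≤ D → F + G ≤ Y + Y → D + D ≤ Y →
    (F ℚ.⊔ D) * (G ℚ.⊔ D) ≤ Y * Y
  ⊔-*-⊔-≤-square {F} {G} {D} {Y} 0≤F 0≤G 0≤D F+G≤2Y 2D≤Y with ℚ.≤-total F D | ℚ.≤-total G D
  ... | inj₁ F≤D | _        = begin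
    (F ℚ.⊔ D) * (G ℚ.⊔ D)  ≡⟨ cong (_* (G ℚ.⊔ D)) (ℚ.p≤q⇒p⊔q≡q F≤D) ⟩
    D * (G ℚ.⊔ D)          ≤⟨ *-≤-square′ 0≤D 2D≤Y (ℚ.⊔-lub G≤2Y D≤2Y) ⟩
    Y * Y                  ∎
    where
    G≤2Y : G ≤ Y + Y
    G≤2Y = ℚ.≤-trans (≤-by F 0≤F (ℚ.+-comm G F)) F+G≤2Y
    D≤2Y : D ≤ Y + Y
    D≤2Y = ℚ.≤-trans (≤-by D 0≤D refl) (ℚ.≤-trans 2D≤Y (≤-by Y (ℚ.≤-trans (0≤+ 0≤D 0≤D) 2D≤Y) refl))
  ... | inj₂ D≤F | inj₁ G≤D = begin
    (F ℚ.⊔ D) * (G ℚ.⊔ D)  ≡⟨ cong₂ _*_ (ℚ.p≥q⇒p⊔q≡p D≤F) (ℚ.p≤q⇒p⊔q≡q G≤D) ⟩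
    F * D                  ≡⟨ ℚ.*-comm F D ⟩
    D * F                  ≤⟨ *-≤-square′ 0≤D 2D≤Y (ℚ.≤-trans (≤-by G 0≤G refl) F+G≤2Y) ⟩
    Y * Y                  ∎
  ... | inj₂ D≤F | inj₂ D≤G = begin
    (F ℚ.⊔ D) * (G ℚ.⊔ D)  ≡⟨ cong₂ _*_ (ℚ.p≥q⇒p⊔q≡p D≤F) (ℚ.p≥q⇒p⊔q≡p D≤G) ⟩
    F * G                  ≤⟨ *-≤-square {Y = Y} 0≤F 0≤G F+G≤2Y ⟩
    Y * Y                  ∎

  arcSum-mono-+ : ∀ {n} (R : Tournament n) (h h′ : Fin n → Fin n → ℚ) c → 0ℚ ≤ c →
    (∀ i j → h i j ≤ h′ i j + c) → arcSum R h ≤ arcSum R h′ + ι n * (ι n * c)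
  arcSum-mono-+ {n} R h h′ c 0≤c h≤h′ = begin
    ∑ℚ (λ i → ∑ℚ (entry h i))
      ≤⟨ ∑ℚ-mono (λ i → ℚ.≤-trans (∑ℚ-mono (λ j → bound i j))
           (ℚ.≤-reflexive (shift (entry h′ i) c))) ⟩
    ∑ℚ (λ i → ∑ℚ (entry h′ i) + ι n * c)
      ≡⟨ shift (λ i → ∑ℚ (entry h′ i)) (ι n * c) ⟩
    ∑ℚ (λ i → ∑ℚ (entry h′ i)) + ι n * (ι n * c) ∎
    where
    open Tournament R
    entry : (Fin n → Fin n → ℚ) → Fin n → Fin n → ℚ
    entry h i j = if i ⇒ j then h i j else 0ℚ
    shift : ∀ (f : Fin n → ℚ) c → ∑ℚ (λ i → f i + c) ≡ ∑ℚ f + ι n * c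
    shift f c = trans (∑ℚ-+ {n} f (λ _ → c)) (cong (_+_ (∑ℚ f)) (∑ℚ-const n c))
    bound : ∀ i j → entry h i j ≤ entry h′ i j + c
    bound i j with i ⇒ j
    ... | true  = h≤h′ i j
    ... | false = subst (0ℚ ≤_) (sym (ℚ.+-identityˡ c)) 0≤c

  γ : ℚ
  γ = + 101 ℚ./ 200

  ι*1/suc+1/suc : ∀ k → ι k * 1/suc k + 1/suc k ≡ 1ℚ
  ι*1/suc+1/suc k = trans
    (solve 2 (λ k e → k :* e :+ e := (con 1ℚ :+ k) :* e) refl (ι k) (1/suc k))
    (trans (cong (_* 1/suc k) (sym (ι-+ 1 k))) (ι*1/suc k))

  module Pointwise {k} (R : Tournament k) (m : ℕ) {{_ : ℕ.NonZero m}}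
    (balanced : ∀ A B → size A ℕ.≤ m → size B ℕ.≤ m → ι (arcs R A B) ≤ γ * (ι m * ι m))
    (ε : ℚ) (0≤ε : 0ℚ ≤ ε) (ε≤½ : ε ≤ ½) (kε+ε≡1 : ι k * ε + ε ≡ 1ℚ) where

    private
      D = ι (2 ℕ.* m)

      kε≤1 : ι k * ε ≤ 1ℚ
      kε≤1 = ≤-by ε 0≤ε kε+ε≡1

      0≤kε : 0ℚ ≤ ι k * ε
      0≤kε = 0≤* (0≤ι k) 0≤ε

      +ε≤2 : ∀ {p} → p ≤ 1ℚ + ε → p + ε ≤ ι 2
      +ε≤2 p≤1+ε = ℚ.+-mono-≤ (ℚ.≤-trans p≤1+ε (ℚ.+-monoʳ-≤ 1ℚ ε≤½)) ε≤½

      -- 0.51 X² − 0.505 (X + 1)² − 1, expanded around X = 1000.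
      absorb : ∀ {X} → ι 1001 ≤ X + 1ℚ → γ * ((X + 1ℚ) * (X + 1ℚ)) + 1ℚ ≤ (+ 51 ℚ./ 100) * (X * X)
      absorb {X} 1001≤Y = ≤-by
        ((+ 1 ℚ./ 200) * (Z * Z) + (+ 899 ℚ./ 100) * Z + (+ 797699 ℚ./ 200))
        (0≤+ (0≤+ (0≤* (ℚ.nonNegative⁻¹ (+ 1 ℚ./ 200)) (0≤* 0≤Z 0≤Z))
                  (0≤* (ℚ.nonNegative⁻¹ (+ 899 ℚ./ 100)) 0≤Z))
             (ℚ.nonNegative⁻¹ (+ 797699 ℚ./ 200)))
        (solve 1 (λ X → con γ :* ((X :+ con 1ℚ) :* (X :+ con 1ℚ)) :+ con 1ℚ :+
            (con (+ 1 ℚ./ 200) :* ((X :+ con 1ℚ :- con (ι 1001)) :* (X :+ con 1ℚ :- con (ι 1001)))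
             :+ con (+ 899 ℚ./ 100) :* (X :+ con 1ℚ :- con (ι 1001)) :+ con (+ 797699 ℚ./ 200))
            := con (+ 51 ℚ./ 100) :* (X :* X)) refl X)
        where
        Z = X + 1ℚ - ι 1001
        0≤Z : 0ℚ ≤ Z
        0≤Z = 0≤- 1001≤Y

    pointwise : ∀ (f g : Fin k → ℚ) X →
      (∀ i → 0ℚ ≤ f i + ε) → (∀ i → f i ≤ 1ℚ + ε) →
      (∀ i → 0ℚ ≤ g i + ε) → (∀ i → g i ≤ 1ℚ + ε) →
      ∑ℚ (λ i → f i + g i) ≤ ι 2 * X + ε →
      D + D ≤ X + 1ℚ → ι 1001 ≤ X + 1ℚ →
      arcSum R (λ i j → f i * g j) ≤ (+ 51 ℚ./ 100) * (X * X)
    pointwise f g X 0≤f f≤1 0≤g g≤1 Σ≤ 2D≤Y 1001≤Y = begin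
      arcSum R (λ i j → f i * g j)
        ≤⟨ arcSum-mono-+ R (λ i j → f i * g j) (λ i j → f′ i * g′ j) (ε * ε)
             (0≤* 0≤ε 0≤ε) (λ i j →
             ≤-by (ε * (f′ i + g′ j)) (0≤* 0≤ε (0≤+ (0≤f i) (0≤g j)))
               (solve 3 (λ f g e → f :* g :+ e :* ((f :+ e) :+ (g :+ e))
                   := (f :+ e) :* (g :+ e) :+ e :* e) refl (f i) (g j) ε)) ⟩
      arcSum R (λ i j → f′ i * g′ j) + ι k * (ι k * (ε * ε))
        ≤⟨ ℚ.+-mono-≤
             (Scaled.arcSum-≤ R m γ balanced f′ g′ P Q 0≤f (+ε≤2 ∘ f≤1) 0≤g (+ε≤2 ∘ g≤1)
               (ℚ.p≤q⊔p F D) (ℚ.p≤q⊔p G D) (ℚ.p≤p⊔q F D) (ℚ.p≤p⊔q G D))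
             (ℚ.≤-trans (ℚ.≤-reflexive (solve 2 (λ k e → k :* (k :* (e :* e))
                 := (k :* e) :* (k :* e)) refl (ι k) ε))
               (*-mono-≤ 0≤kε (*≤* (+≤+ z≤n)) kε≤1 kε≤1)) ⟩
      γ * (P * Q) + 1ℚ
        ≤⟨ ℚ.+-monoˡ-≤ 1ℚ (ℚ.*-monoˡ-≤-nonNeg γ
             (⊔-*-⊔-≤-square (0≤∑ℚ 0≤f) (0≤∑ℚ 0≤g) (0≤ι (2 ℕ.* m)) F+G≤2Y 2D≤Y)) ⟩
      γ * ((X + 1ℚ) * (X + 1ℚ)) + 1ℚ
        ≤⟨ absorb {X} 1001≤Y ⟩
      (+ 51 ℚ./ 100) * (X * X) ∎
      where
      f′ = λ i → f i + ε
      g′ = λ i → g i + ε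
      F = ∑ℚ f′
      G = ∑ℚ g′
      P = F ℚ.⊔ D
      Q = G ℚ.⊔ D
      F+G≤2Y : F + G ≤ (X + 1ℚ) + (X + 1ℚ)
      F+G≤2Y = begin
        F + G
          ≡⟨ ∑ℚ-+ {k} f′ g′ ⟨
        ∑ℚ (λ i → f′ i + g′ i)
          ≡⟨ ∑ℚ-cong {k} (λ i → solve 3 (λ f g e → f :+ e :+ (g :+ e)
                  := f :+ g :+ (e :+ e)) refl (f i) (g i) ε) ⟩
        ∑ℚ (λ i → f i + g i + (ε + ε))
          ≡⟨ trans (∑ℚ-+ {k} (λ i → f i + g i) (λ _ → ε + ε))
             (cong (_+_ (∑ℚ (λ i → f i + g i))) (∑ℚ-const k (ε + ε))) ⟩
        ∑ℚ (λ i → f i + g i) + ι k * (ε + ε)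
          ≤⟨ ℚ.+-monoˡ-≤ (ι k * (ε + ε)) Σ≤ ⟩
        ι 2 * X + ε + ι k * (ε + ε)
          ≡⟨ solve 3 (λ X k e → con (ι 2) :* X :+ e :+ k :* (e :+ e)
                  := con (ι 2) :* X :+ ((k :* e :+ e) :+ k :* e)) refl X (ι k) ε ⟩
        ι 2 * X + ((ι k * ε + ε) + ι k * ε)
          ≤⟨ ℚ.+-monoʳ-≤ (ι 2 * X) (ℚ.+-mono-≤ (ℚ.≤-reflexive kε+ε≡1) kε≤1) ⟩
        ι 2 * X + (1ℚ + 1ℚ)
          ≡⟨ solve 1 (λ X → con (ι 2) :* X :+ (con 1ℚ :+ con 1ℚ)
                  := (X :+ con 1ℚ) :+ (X :+ con 1ℚ)) refl X ⟩
        (X + 1ℚ) + (X + 1ℚ) ∎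

-- Passage to real weights

open import Defs

Eventually : (ℕ → Set) → Set
Eventually P = ∃ λ N → ∀ n → N ℕ.≤ n → P n

_&_ : ∀ {P Q} → Eventually P → Eventually Q → Eventually (λ n → P n × Q n)
(M , p) & (N , q) = M ℕ.⊔ N , λ n le →
  p n (ℕ.m⊔n≤o⇒m≤o M N le) , q n (ℕ.m⊔n≤o⇒n≤o M N le)

infixr 4 _&_

eventually-all : ∀ {k} {P : Fin k → ℕ → Set} →
  (∀ i → Eventually (P i)) → Eventually (λ n → ∀ i → P i n)
eventually-all {zero}  h = 0 , λ _ _ ()
eventually-all {suc k} h with h zero & eventually-all (h ∘ suc)
... | N , p = N , λ { n le zero → proj₁ (p n le) ; n le (suc i) → proj₂ (p n le) i }

seq-∑ : ∀ {k} (F : Fin k → ℝ) n → seq (∑ F) n ≡ ∑ℚ (λ i → seq (F i) n)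
seq-∑ {zero}  F n = refl
seq-∑ {suc k} F n = cong (ℚ._+_ (seq (F zero) n)) (seq-∑ (F ∘ suc) n)

seq-∑E : ∀ {k} (R : Tournament k) h n → seq (∑E R h) n ≡ arcSum R (λ i j → seq (h i j) n)
seq-∑E {k} R h n = trans (seq-∑ (λ i → ∑ λ j → if i ⇒ j then h i j else 0ℝ) n)
  (∑ℚ-cong {k} λ i → trans (seq-∑ (λ j → if i ⇒ j then h i j else 0ℝ) n)
    (∑ℚ-cong {k} λ j → seq-if (i ⇒ j) (h i j)))
  where
  open Tournament R
  seq-if : ∀ b x → seq (if b then x else 0ℝ) n ≡ (if b then seq x n else 0ℚ)
  seq-if true  x = refl
  seq-if false x = refl

p≤∣p∣ : ∀ p → p ℚ.≤ ℚ.∣ p ∣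
p≤∣p∣ p with ℚ.≤-total 0ℚ p
... | inj₁ 0≤p = ℚ.≤-reflexive (sym (ℚ.0≤p⇒∣p∣≡p 0≤p))
... | inj₂ p≤0 = ℚ.≤-trans p≤0 (ℚ.0≤∣p∣ p)

-- (1.01^505 · 0.99^495)^20 ≈ e
gain : 2 ℕ.* 100 ℕ.^ (10100 ℕ.+ 9900) ℕ.≤ 101 ℕ.^ 10100 ℕ.* 99 ℕ.^ 9900
gain = toWitness {a? = 2 ℕ.* 100 ℕ.^ (10100 ℕ.+ 9900) ℕ.≤? 101 ℕ.^ 10100 ℕ.* 99 ℕ.^ 9900} _

doubled-small : ∀ l s c → 8 ℕ.* s ℕ.≤ c →
  ι (2 ℕ.* (suc (suc l) ℕ.* s)) ℚ.+ ι (2 ℕ.* (suc (suc l) ℕ.* s)) ℚ.≤ ι (suc l) ℚ.* ι c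
doubled-small l s c 8s≤c = subst₂ ℚ._≤_ (ι-+ m₂ m₂) (ι-* (suc l) c)
  (ι-mono (ℕ.≤-trans (four-times l s) (ℕ.*-monoʳ-≤ (suc l) 8s≤c)))
  where m₂ = 2 ℕ.* (suc (suc l) ℕ.* s)

record BalancedTournament (k l c : ℕ) : Set where
  field
    m         : ℕ
    {{m≢0}}   : ℕ.NonZero m
    m-small   : ι (2 ℕ.* m) ℚ.+ ι (2 ℕ.* m) ℚ.≤ ι l ℚ.* ι c
    R         : Tournament k
    balanced  : ∀ A B → size A ℕ.≤ m → size B ℕ.≤ m → ι (arcs R A B) ℚ.≤ γ ℚ.* (ι m ℚ.* ι m)

module Bias = Balanced 101 99 100 10100 9900
  (ℕ.≤ᵇ⇒≤ 99 100 _) (ℕ.≤ᵇ⇒≤ 100 101 _) (ℕ.≤ᵇ⇒≤ 200 200 _) (ℕ.≤ᵇ⇒≤ 9999 10000 _) gain γ refl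

balancedTournament : ∀ s t c .{{_ : ℕ.NonZero s}} →
  s ℕ.* s ≡ (10100 ℕ.+ 9900) ℕ.* t → 2 ℕ.* s ℕ.< t → 8 ℕ.* s ℕ.≤ c →
  ∀ k l → k ℕ.< 2 ℕ.^ suc (suc l) → BalancedTournament k (suc l) c
balancedTournament s t c s*s≡ 2s<t 8s≤c k l k<2^L = record
  { m        = suc (suc l) ℕ.* s
  ; m≢0      = ℕ.m*n≢0 (suc (suc l)) s
  ; m-small  = doubled-small l s c 8s≤c
  ; R        = proj₁ R′
  ; balanced = proj₂ R′
  }
  where R′ = Bias.balanced s t s*s≡ 2s<t k (suc (suc l)) k<2^L

scale-log : ∀ c d p → c ℚ.* ½ ℚ.* ½ ≡ d → p ℚ.* d ≡ c ℚ.* (p ℚ.* ½) ℚ.* ½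
scale-log c d p refl = solve 2 (λ c p → p :* (c :* con ½ :* con ½)
    := c :* (p :* con ½) :* con ½) refl c p
  where open ℚ-Solver.+-*-Solver using (solve; _:=_; _:*_; con)

arcSum-limit : ∀ {k} (R : Tournament k) m {{_ : ℕ.NonZero m}} →
  (∀ A B → size A ℕ.≤ m → size B ℕ.≤ m → ι (arcs R A B) ℚ.≤ γ ℚ.* (ι m ℚ.* ι m)) →
  ∀ ε → 0ℚ ℚ.< ε → ε ℚ.≤ ½ → ι k ℚ.* ε ℚ.+ ε ≡ 1ℚ →
  ∀ x → Eventually (λ t →
    ι (2 ℕ.* m) ℚ.+ ι (2 ℕ.* m) ℚ.≤ seq x t ℚ.+ 1ℚ × ι 1001 ℚ.≤ seq x t ℚ.+ 1ℚ) →
  ∀ (f g : Fin k → ℝ) →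
  (∀ i → 0ℝ ≤ f i) → (∀ i → f i ≤ 1ℝ) → (∀ i → 0ℝ ≤ g i) → (∀ i → g i ≤ 1ℝ) →
  ∑ (λ i → f i + g i) ≃ fromℕ 2 * x →
  ∑E R (λ i j → f i * g j) ≤ fromℚ (+ 51 ℚ./ 100) * (x * x)
arcSum-limit {k} R m balanced ε 0<ε ε≤½ kε+ε≡1 x large f g 0≤f f≤1 0≤g g≤1 Σ≃2x η 0<η =
  proj₁ all , λ t N≤t →
    let 0≤f′ , f′≤1 , 0≤g′ , g′≤1 , Σ′ , 2D≤ , 1001≤ = proj₂ all t N≤t
        X = seq x t
    in begin
      seq (∑E R (λ i j → f i * g j)) t
        ≡⟨ seq-∑E R (λ i j → f i * g j) t ⟩
      arcSum R (λ i j → seq (f i) t ℚ.* seq (g j) t)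
        ≤⟨ Pointwise.pointwise R m balanced ε (ℚ.<⇒≤ 0<ε) ε≤½ kε+ε≡1
             (λ i → seq (f i) t) (λ i → seq (g i) t) X
             0≤f′ f′≤1 0≤g′ g′≤1 Σ′ 2D≤ 1001≤ ⟩
      (+ 51 ℚ./ 100) ℚ.* (X ℚ.* X)
        ≤⟨ ≤-by η (ℚ.<⇒≤ 0<η) refl ⟩
      (+ 51 ℚ./ 100) ℚ.* (X ℚ.* X) ℚ.+ η ∎
  where
  open ℚ.≤-Reasoning
  open ℚ-Solver.+-*-Solver using (solve; _:=_; _:+_; _:*_; _:-_; con)
  near : ∀ {p q} → ℚ.∣ p ℚ.- q ∣ ℚ.≤ ε → p ℚ.≤ q ℚ.+ ε
  near {p} {q} h = begin
    p                     ≡⟨ solve 2 (λ p q → p := q :+ (p :- q)) refl p q ⟩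
    q ℚ.+ (p ℚ.- q)       ≤⟨ ℚ.+-monoʳ-≤ q (ℚ.≤-trans (p≤∣p∣ (p ℚ.- q)) h) ⟩
    q ℚ.+ ε               ∎
  Lower Upper : (Fin k → ℝ) → ℕ → Set
  Lower f t = ∀ i → 0ℚ ℚ.≤ seq (f i) t ℚ.+ ε
  Upper f t = ∀ i → seq (f i) t ℚ.≤ 1ℚ ℚ.+ ε
  Total Large : ℕ → Set
  Total t = ∑ℚ (λ i → seq (f i) t ℚ.+ seq (g i) t) ℚ.≤ ι 2 ℚ.* seq x t ℚ.+ ε
  Large t = ι (2 ℕ.* m) ℚ.+ ι (2 ℕ.* m) ℚ.≤ seq x t ℚ.+ 1ℚ × ι 1001 ℚ.≤ seq x t ℚ.+ 1ℚ
  lower : ∀ f → (∀ i → 0ℝ ≤ f i) → Eventually (Lower f)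
  lower f 0≤f = eventually-all {P = λ i t → 0ℚ ℚ.≤ seq (f i) t ℚ.+ ε} λ i → 0≤f i ε 0<ε
  upper : ∀ f → (∀ i → f i ≤ 1ℝ) → Eventually (Upper f)
  upper f f≤1 = eventually-all {P = λ i t → seq (f i) t ℚ.≤ 1ℚ ℚ.+ ε} λ i → f≤1 i ε 0<ε
  total : Eventually Total
  total = proj₁ (Σ≃2x ε 0<ε) , λ t N≤t →
    ℚ.≤-trans (ℚ.≤-reflexive (sym (seq-∑ (λ i → f i + g i) t)))
      (near (proj₂ (Σ≃2x ε 0<ε) t N≤t))
  all : Eventually (λ t → Lower f t × Upper f t × Lower g t × Upper g t × Total t × Large t)
  all = _&_ {Lower f} (lower f 0≤f) (_&_ {Upper f} (upper f f≤1) (_&_ {Lower g} (lower g 0≤g)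
    (_&_ {Upper g} (upper g g≤1) (_&_ {Total} {Large} total large))))

eventually-large : ∀ C N n l x → ι C ℚ.* ½ ℚ.* ½ ≡ ι N → 2 ℕ.^ l ℕ.≤ suc n →
  fromℕ C * log (suc n) * fromℚ ½ ≤ x → Eventually (λ t → ι l ℚ.* ι N ℚ.≤ seq x t ℚ.+ 1ℚ)
eventually-large C N n l x C/4≡N 2^l≤k h = proj₁ h₁ , λ t M≤t → begin
    ι l ℚ.* ι N                          ≡⟨ scale-log (ι C) (ι N) (ι l) C/4≡N ⟩
    ι C ℚ.* (ι l ℚ.* ½) ℚ.* ½            ≤⟨ ℚ.*-monoʳ-≤-nonNeg ½
                                              (ℚ.*-monoˡ-≤-nonNeg (ι C) (logSeq-≥ n l t 2^l≤k)) ⟩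
    ι C ℚ.* logSeq (suc n) t ℚ.* ½       ≤⟨ proj₂ h₁ t M≤t ⟩
    seq x t ℚ.+ 1ℚ                       ∎
  where
  open ℚ.≤-Reasoning
  h₁ = h 1ℚ (ℚ.positive⁻¹ 1ℚ)

bound-from-tournament : ∀ C N n l → BalancedTournament (suc n) l N →
  1001 ℕ.≤ l ℕ.* N → ι C ℚ.* ½ ℚ.* ½ ≡ ι N → 2 ℕ.^ l ℕ.≤ suc n →
  (x : ℝ) → fromℕ C * log (suc n) * fromℚ ½ ≤ x →
  Σ[ R ∈ Tournament (suc n) ] ((f g : Fin (suc n) → ℝ) →
    (∀ i → 0ℝ ≤ f i) → (∀ i → f i ≤ 1ℝ) → (∀ i → 0ℝ ≤ g i) → (∀ i → g i ≤ 1ℝ) →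
    (∀ i → f i + g i ≤ 1ℝ) → ∑ (λ i → f i + g i) ≃ fromℕ 2 * x →
    ∑E R (λ i j → f i * g j) ≤ fromℚ (+ 51 ℚ./ 100) * (x * x))
bound-from-tournament C N n l G 1001≤lN C/4≡N 2^l≤k x h = R , λ f g 0≤f f≤1 0≤g g≤1 _ →
  arcSum-limit R m balanced (1/suc (suc n)) (ℚ.positive⁻¹ (1/suc (suc n)))
    (1/suc-anti-≤ {1} (s≤s z≤n)) (ι*1/suc+1/suc (suc n)) x
    (proj₁ lower , λ t M≤t → ℚ.≤-trans m-small (proj₂ lower t M≤t) ,
      ℚ.≤-trans (ℚ.≤-trans (ι-mono 1001≤lN) (ℚ.≤-reflexive (ι-* l N))) (proj₂ lower t M≤t))
    f g 0≤f f≤1 0≤g g≤1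
  where
  open BalancedTournament G
  lower = eventually-large C N n l x C/4≡N 2^l≤k h

-- The numerals of the theorem are variables here: comparing terms that contain the
-- literals would unfold them in unary.
bound-from-constants : ∀ C N s t .{{_ : ℕ.NonZero s}} →
  s ℕ.* s ≡ (10100 ℕ.+ 9900) ℕ.* t → 2 ℕ.* s ℕ.< t →
  8 ℕ.* s ℕ.≤ N → 1001 ℕ.≤ N → ι C ℚ.* ½ ℚ.* ½ ≡ ι N →
  (k : ℕ) → 2 ℕ.≤ k → (x : ℝ) → fromℕ C * log k * fromℚ ½ ≤ x →
  Σ[ R ∈ Tournament k ] ((f g : Fin k → ℝ) →
    (∀ i → 0ℝ ≤ f i) → (∀ i → f i ≤ 1ℝ) → (∀ i → 0ℝ ≤ g i) → (∀ i → g i ≤ 1ℝ) →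
    (∀ i → f i + g i ≤ 1ℝ) → ∑ (λ i → f i + g i) ≃ fromℕ 2 * x →
    ∑E R (λ i j → f i * g j) ≤ fromℚ (+ 51 ℚ./ 100) * (x * x))
bound-from-constants C N s t s*s≡ 2s<t 8s≤N 1001≤N C/4≡N (suc zero) (s≤s ()) x h
bound-from-constants C N s t s*s≡ 2s<t 8s≤N 1001≤N C/4≡N (suc (suc n)) _ x h =
  let l , 2^l≤k , k<2^L = log₂ n in
  bound-from-tournament C N (suc n) (suc l)
    (balancedTournament s t N s*s≡ 2s<t 8s≤N (suc (suc n)) l k<2^L)
    (ℕ.≤-trans 1001≤N (ℕ.m≤n*m N (suc l))) C/4≡N 2^l≤k x h

-- Here 25000000 = 10⁸/4, as log k ≥ l/2 when k ≥ 2^l; and m = 100000 L, where k < 2^L.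
lemma3p3 : (k : ℕ) → 2 ℕ.≤ k →
    (x : ℝ) → fromℕ (10 ℕ.^ 8) * log k * fromℚ ½ ≤ x →
    Σ[ R ∈ Tournament k ]
    ((f g : Fin k → ℝ) →
    (∀ i → 0ℝ ≤ f i) → (∀ i → f i ≤ 1ℝ) →
    (∀ i → 0ℝ ≤ g i) → (∀ i → g i ≤ 1ℝ) →
    (∀ i → f i + g i ≤ 1ℝ) →
    ∑ (λ i → f i + g i) ≃ fromℕ 2 * x →
    ∑E R (λ i j → f i * g j) ≤ fromℚ (+ 51 ℚ./ 100) * (x * x))
lemma3p3 = bound-from-constants (10 ℕ.^ 8) 25000000 100000 500000 refl (ℕ.≤ᵇ⇒≤ 200001 500000 _)
  (ℕ.≤ᵇ⇒≤ 800000 25000000 _) (ℕ.≤ᵇ⇒≤ 1001 25000000 _) refl
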